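{- Let $k\ge2$ and let $\alpha$ be a simple ordered rational $k$-cone in $\mathbb{R}^n$. Then for all $i\in\{1,2,\ldots,k\}$ $$\operatorname{lsin}_k\alpha=\operatorname{lsin}_k(\pi_i-\alpha).$$
   Context: An ordered rational $k$-cone $\alpha$ in $\mathbb{R}^n$ ($k\le n$) is given by a vertex $A_0\in\mathbb{Z}^n$ and an ordered tuple $(v_1,\ldots,v_k)$ of linearly independent primitive integer vectors (its edge vectors); as a set it is $\{A_0+\sum\lambda_iv_i:\lambda_i\ge0\}$. Let $\Gamma=\mathbb{Z}^n\cap\operatorname{span}_{\mathbb{R}}(v_1,\ldots,v_k)$. There is a unique $\mathbb{Z}$-basis $e_1,\ldots,e_k$ of $\Gamma$ such that $v_i=\sum_{j\le i}a_{j,i}e_j$ with $a_{i,i}>0$ and $0\le a_{j,i}<a_{i,i}$ for $j<i$. The $i$-th integer sine is $\operatorname{lsin}_i\alpha=a_{i,i}$. The integer sine of a rational $m$-cone $\beta$ with primitive edge vectors $w_1,\ldots,w_m$ is the index $\operatorname{lsin}(\beta)=[\mathbb{Z}^n\cap\operatorname{span}_{\mathbb{R}}(w_1,\ldots,w_m):\mathbb{Z}w_1+\cdots+\mathbb{Z}w_m]$. The cone $\alpha$ is simple if every $(k-1)$-dimensional face $\beta$ of $\alpha$ (the cone with vertex $A_0$ generated by $k-1$ of the vectors $v_i$) satisfies $\operatorname{lsin}(\beta)=1$. For $i\in\{1,\ldots,k\}$ the $i$-th adjacent cone $\pi_i-\alpha$ is the cone with the same vertex and ordered edge vectors $(v_1,\ldots,v_{i-1},-v_i,v_{i+1},\ldots,v_k)$.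 -}

module Defs where

open import Algebra.Bundles using (CommutativeRing)
import Algebra.Properties.Ring
import Algebra.Properties.Semiring.Sum as SemiringSum
open import Data.Empty using (⊥-elim)
open import Data.Fin using (Fin; zero; suc; punchIn)
import Data.Fin as Fin
open import Data.Integer using (ℤ; +_; 0ℤ; 1ℤ; -1ℤ)
import Data.Integer as ℤ
import Data.Integer.DivMod as ℤ
import Data.Integer.Properties as ℤ
open import Data.Integer.Tactic.RingSolver using () renaming (solve-∀ to ℤ-solve)
open import Data.Nat using (ℕ; zero; suc)
import Data.Nat as ℕ
import Data.Nat.Properties as ℕ
open import Data.Nat.Divisibility using (_∣_; divides)
open import Data.Nat.GCD using (module GCD; module Bézout)
open import Data.Product using (Σ; ∃-syntax; _×_; _,_; proj₁; proj₂)
open import Data.Rational using (ℚ; 0ℚ; 1ℚ; ½)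
import Data.Rational as ℚ
import Data.Rational.Properties as ℚ
open import Data.Rational.Unnormalised using (mkℚᵘ; *≡*)
import Data.Rational.Unnormalised as ℚᵘ
import Data.Rational.Unnormalised.Properties as ℚᵘ
open import Data.Sum using (inj₁; inj₂)
open import Data.Vec.Functional using (Vector; tail; _∷_; removeAt; insertAt; updateAt)
import Data.Vec.Functional.Properties as Vec
open import Function using (_∘_)
open import Level using (0ℓ)
open import Relation.Binary.PropositionalEquality
  using (_≡_; _≗_; refl; sym; trans; cong; cong₂; subst)
open import Relation.Nullary using (¬_; yes; no; contradiction)
open import Relation.Nullary.Decidable using (dec⇒maybe)
open import Relation.Unary using (Pred; _∈_)
open import Tactic.RingSolver using (solve-∀)
import Tactic.RingSolver.Core.AlmostCommutativeRing as ACR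

-- Real numbers: Cauchy sequences of rationals (with an explicit modulus), equal when
-- their difference tends to 0.

record ℝ : Set where
  field
    seq    : ℕ → ℚ
    cauchy : ∀ ε → 0ℚ ℚ.< ε → ∃[ N ] (∀ p q → N ℕ.≤ p → N ℕ.≤ q → ℚ.∣ seq p ℚ.- seq q ∣ ℚ.< ε)

open ℝ

record _≈ᴿ_ (x y : ℝ) : Set where
  constructor tends
  field
    close : ∀ ε → 0ℚ ℚ.< ε → ∃[ N ] (∀ p → N ℕ.≤ p → ℚ.∣ seq x p ℚ.- seq y p ∣ ℚ.< ε)

open _≈ᴿ_

infix 4 _≈ᴿ_

private
  ringℚ : ACR.AlmostCommutativeRing 0ℓ 0ℓ
  ringℚ = ACR.fromCommutativeRing ℚ.+-*-commutativeRing (λ x → dec⇒maybe (0ℚ ℚ.≟ x))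

  -- Families tending to 0; i After N says that the index i lies beyond N.
  module Null {I : Set} (_After_ : I → ℕ → Set)
              (weaken : ∀ {i M N} → M ℕ.≤ N → i After N → i After M) where

    Null : (I → ℚ) → Set
    Null s = ∀ ε → 0ℚ ℚ.< ε → ∃[ N ] (∀ i → i After N → ℚ.∣ s i ∣ ℚ.< ε)

    Bounded : (I → ℚ) → Set
    Bounded b = ∃[ B ] 0ℚ ℚ.< B × ∃[ N ] (∀ i → i After N → ℚ.∣ b i ∣ ℚ.≤ B)

    null-≗ : ∀ s t → s ≗ t → Null s → Null t
    null-≗ s t s≗t ns ε ε>0 with ns ε ε>0
    ... | N , p = N , λ i i≥N → subst (λ z → ℚ.∣ z ∣ ℚ.< ε) (s≗t i) (p i i≥N)

    null-0 : Null (λ _ → 0ℚ)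
    null-0 ε ε>0 = 0 , λ _ _ → ε>0

    null-neg : ∀ s → Null s → Null (λ i → ℚ.- s i)
    null-neg s ns ε ε>0 with ns ε ε>0
    ... | N , p = N , λ i i≥N → subst (ℚ._< ε) (sym (ℚ.∣-p∣≡∣p∣ (s i))) (p i i≥N)

    null-+ : ∀ s t → Null s → Null t → Null (λ i → s i ℚ.+ t i)
    null-+ s t ns nt ε ε>0 = M ℕ.⊔ N , λ i i≥ → ℚ.≤-<-trans (ℚ.∣p+q∣≤∣p∣+∣q∣ (s i) (t i))
        (subst (ℚ.∣ s i ∣ ℚ.+ ℚ.∣ t i ∣ ℚ.<_) halves
          (ℚ.+-mono-< (proj₂ (ns ½ε ½ε>0) i (weaken (ℕ.m≤m⊔n M N) i≥))
                      (proj₂ (nt ½ε ½ε>0) i (weaken (ℕ.m≤n⊔m M N) i≥))))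
      where
      ½ε : ℚ
      ½ε = ½ ℚ.* ε
      ½ε>0 : 0ℚ ℚ.< ½ε
      ½ε>0 = subst (ℚ._< ½ε) (ℚ.*-zeroʳ ½) (ℚ.*-monoʳ-<-pos ½ ε>0)
      halves : ½ε ℚ.+ ½ε ≡ ε
      halves = trans (sym (ℚ.*-distribʳ-+ ε ½ ½)) (ℚ.*-identityˡ ε)
      M N : ℕ
      M = proj₁ (ns ½ε ½ε>0)
      N = proj₁ (nt ½ε ½ε>0)

    null-* : ∀ b s → Bounded b → Null s → Null (λ i → b i ℚ.* s i)
    null-* b s (B , B>0 , M , bb) ns ε ε>0 = M ℕ.⊔ N , λ i i≥ →
        subst (ℚ._< ε) (sym (ℚ.∣p*q∣≡∣p∣*∣q∣ (b i) (s i)))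
          (ℚ.≤-<-trans (mono i (bb i (weaken (ℕ.m≤m⊔n M N) i≥)))
            (subst (B ℚ.* ℚ.∣ s i ∣ ℚ.<_) Bδ
              (ℚ.*-monoʳ-<-pos B (proj₂ (ns δ δ>0) i (weaken (ℕ.m≤n⊔m M N) i≥)))))
      where
      instance
        posB : ℚ.Positive B
        posB = ℚ.positive B>0
        nzB : ℚ.NonZero B
        nzB = ℚ.pos⇒nonZero B
        pos1/B : ℚ.Positive (ℚ.1/ B)
        pos1/B = ℚ.1/pos⇒pos B
      δ : ℚ
      δ = (ℚ.1/ B) ℚ.* ε
      δ>0 : 0ℚ ℚ.< δ
      δ>0 = subst (ℚ._< δ) (ℚ.*-zeroʳ (ℚ.1/ B)) (ℚ.*-monoʳ-<-pos (ℚ.1/ B) ε>0)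
      Bδ : B ℚ.* δ ≡ ε
      Bδ = trans (sym (ℚ.*-assoc B (ℚ.1/ B) ε))
             (trans (cong (ℚ._* ε) (ℚ.*-inverseʳ B)) (ℚ.*-identityˡ ε))
      N : ℕ
      N = proj₁ (ns δ δ>0)
      mono : ∀ i → ℚ.∣ b i ∣ ℚ.≤ B → ℚ.∣ b i ∣ ℚ.* ℚ.∣ s i ∣ ℚ.≤ B ℚ.* ℚ.∣ s i ∣
      mono i le = ℚ.*-monoʳ-≤-nonNeg ℚ.∣ s i ∣ {{ℚ.∣-∣-nonNeg (s i)}} le

  module N₁ = Null {ℕ} (λ p N → N ℕ.≤ p) ℕ.≤-trans
  module N₂ = Null {ℕ × ℕ} (λ pq N → N ℕ.≤ proj₁ pq × N ℕ.≤ proj₂ pq)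
                   (λ M≤N le → ℕ.≤-trans M≤N (proj₁ le) , ℕ.≤-trans M≤N (proj₂ le))

  gap : ℝ → ℕ × ℕ → ℚ
  gap x pq = seq x (proj₁ pq) ℚ.- seq x (proj₂ pq)

  gap-null : ∀ x → N₂.Null (gap x)
  gap-null x ε ε>0 with cauchy x ε ε>0
  ... | N , p = N , λ pq le → p (proj₁ pq) (proj₂ pq) (proj₁ le) (proj₂ le)

  mkℝ : (s : ℕ → ℚ) → N₂.Null (λ pq → s (proj₁ pq) ℚ.- s (proj₂ pq)) → ℝ
  mkℝ s ns = record { seq = s ; cauchy = λ ε ε>0 → proj₁ (ns ε ε>0)
                    , λ p q N≤p N≤q → proj₂ (ns ε ε>0) (p , q) (N≤p , N≤q) }

  bounded : ∀ x → N₁.Bounded (seq x)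
  bounded x with cauchy x 1ℚ (ℚ.positive⁻¹ 1ℚ)
  ... | N , c = 1ℚ ℚ.+ ℚ.∣ seq x N ∣
      , ℚ.<-≤-trans (ℚ.positive⁻¹ 1ℚ) (subst (ℚ._≤ 1ℚ ℚ.+ ℚ.∣ seq x N ∣) (ℚ.+-identityʳ 1ℚ)
          (ℚ.+-monoʳ-≤ 1ℚ (ℚ.0≤∣p∣ (seq x N))))
      , N , λ p N≤p → subst (λ z → ℚ.∣ z ∣ ℚ.≤ 1ℚ ℚ.+ ℚ.∣ seq x N ∣) (r1 (seq x p) (seq x N))
          (ℚ.≤-trans (ℚ.∣p+q∣≤∣p∣+∣q∣ (seq x p ℚ.- seq x N) (seq x N))
            (ℚ.+-monoˡ-≤ ℚ.∣ seq x N ∣ (ℚ.<⇒≤ (c p N N≤p ℕ.≤-refl))))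
    where
    r1 : ∀ a b → (a ℚ.- b) ℚ.+ b ≡ a
    r1 a b = trans (ℚ.+-assoc a (ℚ.- b) b) (trans (cong (a ℚ.+_) (ℚ.+-inverseˡ b)) (ℚ.+-identityʳ a))

  bounded₂ : ∀ x (π : ℕ × ℕ → ℕ) → (∀ {pq N} → N ℕ.≤ proj₁ pq × N ℕ.≤ proj₂ pq → N ℕ.≤ π pq) →
             N₂.Bounded (seq x ∘ π)
  bounded₂ x π le with bounded x
  ... | B , B>0 , N , b = B , B>0 , N , λ pq after → b (π pq) (le {pq} after)

  -- Sealed so that terms of type ℝ have small normal forms.
  abstract
    const-cauchy : ∀ q → N₂.Null (λ _ → q ℚ.- q)
    const-cauchy q = N₂.null-≗ (λ _ → 0ℚ) (λ _ → q ℚ.- q) (λ _ → sym (ℚ.+-inverseʳ q)) N₂.null-0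

    +-cauchy : ∀ x y → N₂.Null (λ pq → (seq x (proj₁ pq) ℚ.+ seq y (proj₁ pq))
                                   ℚ.- (seq x (proj₂ pq) ℚ.+ seq y (proj₂ pq)))
    +-cauchy x y = N₂.null-≗ (λ pq → gap x pq ℚ.+ gap y pq) _
        (λ pq → r1 (seq x (proj₁ pq)) (seq y (proj₁ pq)) (seq x (proj₂ pq)) (seq y (proj₂ pq)))
        (N₂.null-+ (gap x) (gap y) (gap-null x) (gap-null y))
      where
      r1 : ∀ a b c d → (a ℚ.- c) ℚ.+ (b ℚ.- d) ≡ (a ℚ.+ b) ℚ.- (c ℚ.+ d)
      r1 = solve-∀ ringℚ

    neg-cauchy : ∀ x → N₂.Null (λ pq → (ℚ.- seq x (proj₁ pq)) ℚ.- (ℚ.- seq x (proj₂ pq)))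
    neg-cauchy x = N₂.null-≗ (λ pq → ℚ.- gap x pq) _
        (λ pq → r1 (seq x (proj₁ pq)) (seq x (proj₂ pq))) (N₂.null-neg (gap x) (gap-null x))
      where
      r1 : ∀ a b → ℚ.- (a ℚ.- b) ≡ (ℚ.- a) ℚ.- (ℚ.- b)
      r1 = solve-∀ ringℚ

    *-cauchy : ∀ x y → N₂.Null (λ pq → seq x (proj₁ pq) ℚ.* seq y (proj₁ pq)
                                   ℚ.- seq x (proj₂ pq) ℚ.* seq y (proj₂ pq))
    *-cauchy x y = N₂.null-≗ (λ pq → seq x (proj₁ pq) ℚ.* gap y pq ℚ.+ seq y (proj₂ pq) ℚ.* gap x pq) _
        (λ pq → r1 (seq x (proj₁ pq)) (seq y (proj₁ pq)) (seq x (proj₂ pq)) (seq y (proj₂ pq)))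
        (N₂.null-+ (λ pq → seq x (proj₁ pq) ℚ.* gap y pq) (λ pq → seq y (proj₂ pq) ℚ.* gap x pq)
          (N₂.null-* (seq x ∘ proj₁) (gap y) (bounded₂ x proj₁ proj₁) (gap-null y))
          (N₂.null-* (seq y ∘ proj₂) (gap x) (bounded₂ y proj₂ proj₂) (gap-null x)))
      where
      r1 : ∀ a b c d → a ℚ.* (b ℚ.- d) ℚ.+ d ℚ.* (a ℚ.- c) ≡ a ℚ.* b ℚ.- c ℚ.* d
      r1 = solve-∀ ringℚ

fromℚ : ℚ → ℝ
fromℚ q = mkℝ (λ _ → q) (const-cauchy q)

infixl 6 _+ᴿ_
infixl 7 _*ᴿ_
infix  8 -ᴿ_

_+ᴿ_ _*ᴿ_ : ℝ → ℝ → ℝ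
x +ᴿ y = mkℝ (λ p → seq x p ℚ.+ seq y p) (+-cauchy x y)
x *ᴿ y = mkℝ (λ p → seq x p ℚ.* seq y p) (*-cauchy x y)

-ᴿ_ : ℝ → ℝ
-ᴿ x = mkℝ (λ p → ℚ.- seq x p) (neg-cauchy x)

private
  null : ∀ {x y} → N₁.Null (λ p → seq x p ℚ.- seq y p) → x ≈ᴿ y
  null = tends

  pointwise : ∀ {x y} → seq x ≗ seq y → x ≈ᴿ y
  pointwise {x} {y} eq = tends (N₁.null-≗ (λ _ → 0ℚ) _
    (λ p → sym (trans (cong (λ z → z ℚ.- seq y p) (eq p)) (ℚ.+-inverseʳ (seq y p)))) N₁.null-0)

  ≈-sym : ∀ {x y} → x ≈ᴿ y → y ≈ᴿ x
  ≈-sym {x} {y} e = tends (N₁.null-≗ _ _ (λ p → r1 (seq x p) (seq y p)) (N₁.null-neg _ (close e)))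
    where
    r1 : ∀ a b → ℚ.- (a ℚ.- b) ≡ b ℚ.- a
    r1 = solve-∀ ringℚ

  ≈-trans : ∀ {x y z} → x ≈ᴿ y → y ≈ᴿ z → x ≈ᴿ z
  ≈-trans {x} {y} {z} e f = tends (N₁.null-≗ _ _ (λ p → r1 (seq x p) (seq y p) (seq z p))
                              (N₁.null-+ _ _ (close e) (close f)))
    where
    r1 : ∀ a b c → (a ℚ.- b) ℚ.+ (b ℚ.- c) ≡ a ℚ.- c
    r1 = solve-∀ ringℚ

  +-congᴿ : ∀ {x x′ y y′} → x ≈ᴿ x′ → y ≈ᴿ y′ → (x +ᴿ y) ≈ᴿ (x′ +ᴿ y′)
  +-congᴿ {x} {x′} {y} {y′} e f = tends (N₁.null-≗ _ _
      (λ p → r1 (seq x p) (seq x′ p) (seq y p) (seq y′ p)) (N₁.null-+ _ _ (close e) (close f)))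
    where
    r1 : ∀ a b c d → (a ℚ.- b) ℚ.+ (c ℚ.- d) ≡ (a ℚ.+ c) ℚ.- (b ℚ.+ d)
    r1 = solve-∀ ringℚ

  -‿congᴿ : ∀ {x x′} → x ≈ᴿ x′ → (-ᴿ x) ≈ᴿ (-ᴿ x′)
  -‿congᴿ {x} {x′} e = tends (N₁.null-≗ _ _ (λ p → r1 (seq x p) (seq x′ p)) (N₁.null-neg _ (close e)))
    where
    r1 : ∀ a b → ℚ.- (a ℚ.- b) ≡ (ℚ.- a) ℚ.- (ℚ.- b)
    r1 = solve-∀ ringℚ

  *-congᴿ : ∀ {x x′ y y′} → x ≈ᴿ x′ → y ≈ᴿ y′ → (x *ᴿ y) ≈ᴿ (x′ *ᴿ y′)
  *-congᴿ {x} {x′} {y} {y′} e f = tends (N₁.null-≗ _ _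
      (λ p → r1 (seq x p) (seq x′ p) (seq y p) (seq y′ p))
      (N₁.null-+ _ _ (N₁.null-* (seq x) _ (bounded x) (close f)) (N₁.null-* (seq y′) _ (bounded y′) (close e))))
    where
    r1 : ∀ a b c d → a ℚ.* (c ℚ.- d) ℚ.+ d ℚ.* (a ℚ.- b) ≡ a ℚ.* c ℚ.- b ℚ.* d
    r1 = solve-∀ ringℚ

ℝ-commutativeRing : CommutativeRing 0ℓ 0ℓ
ℝ-commutativeRing = record
  { Carrier = ℝ ; _≈_ = _≈ᴿ_ ; _+_ = _+ᴿ_ ; _*_ = _*ᴿ_ ; -_ = -ᴿ_ ; 0# = fromℚ 0ℚ ; 1# = fromℚ 1ℚ
  ; isCommutativeRing = record
    { isRing = record
      { +-isAbelianGroup = record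
        { isGroup = record
          { isMonoid = record
            { isSemigroup = record
              { isMagma = record
                { isEquivalence = record
                  { refl = pointwise (λ _ → refl) ; sym = ≈-sym ; trans = ≈-trans }
                ; ∙-cong = +-congᴿ }
              ; assoc = λ x y z → pointwise (λ p → ℚ.+-assoc (seq x p) (seq y p) (seq z p)) }
            ; identity = (λ x → pointwise (λ p → ℚ.+-identityˡ (seq x p)))
                       , (λ x → pointwise (λ p → ℚ.+-identityʳ (seq x p))) }
          ; inverse = (λ x → pointwise (λ p → ℚ.+-inverseˡ (seq x p)))
                    , (λ x → pointwise (λ p → ℚ.+-inverseʳ (seq x p)))
          ; ⁻¹-cong = -‿congᴿ }
        ; comm = λ x y → pointwise (λ p → ℚ.+-comm (seq x p) (seq y p)) }
      ; *-cong = *-congᴿ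
      ; *-assoc = λ x y z → pointwise (λ p → ℚ.*-assoc (seq x p) (seq y p) (seq z p))
      ; *-identity = (λ x → pointwise (λ p → ℚ.*-identityˡ (seq x p)))
                   , (λ x → pointwise (λ p → ℚ.*-identityʳ (seq x p)))
      ; distrib = (λ x y z → pointwise (λ p → ℚ.*-distribˡ-+ (seq x p) (seq y p) (seq z p)))
                , (λ x y z → pointwise (λ p → ℚ.*-distribʳ-+ (seq x p) (seq y p) (seq z p))) }
    ; *-comm = λ x y → pointwise (λ p → ℚ.*-comm (seq x p) (seq y p)) } }

ℤ→ℚ : ℤ → ℚ
ℤ→ℚ z = z ℚ./ 1

fromℤ : ℤ → ℝ
fromℤ z = fromℚ (ℤ→ℚ z)

private
  toᵘ : ∀ z → ℚ.toℚᵘ (ℤ→ℚ z) ℚᵘ.≃ mkℚᵘ z 0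
  toᵘ z = ℚ.toℚᵘ-fromℚᵘ (mkℚᵘ z 0)

  ℤ→ℚ-+ : ∀ x y → ℤ→ℚ (x ℤ.+ y) ≡ ℤ→ℚ x ℚ.+ ℤ→ℚ y
  ℤ→ℚ-+ x y = ℚ.toℚᵘ-injective (ℚᵘ.≃-trans (toᵘ (x ℤ.+ y)) (ℚᵘ.≃-trans
    (*≡* (cong (ℤ._* 1ℤ) (cong₂ ℤ._+_ (sym (ℤ.*-identityʳ x)) (sym (ℤ.*-identityʳ y)))))
    (ℚᵘ.≃-sym (ℚᵘ.≃-trans (ℚ.toℚᵘ-homo-+ (ℤ→ℚ x) (ℤ→ℚ y)) (ℚᵘ.+-cong (toᵘ x) (toᵘ y))))))

  ℤ→ℚ-* : ∀ x y → ℤ→ℚ (x ℤ.* y) ≡ ℤ→ℚ x ℚ.* ℤ→ℚ y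
  ℤ→ℚ-* x y = ℚ.toℚᵘ-injective (ℚᵘ.≃-trans (toᵘ (x ℤ.* y)) (ℚᵘ.≃-trans (*≡* refl)
    (ℚᵘ.≃-sym (ℚᵘ.≃-trans (ℚ.toℚᵘ-homo-* (ℤ→ℚ x) (ℤ→ℚ y)) (ℚᵘ.*-cong (toᵘ x) (toᵘ y))))))

  ℤ→ℚ-zero : ∀ x → ℤ→ℚ x ≡ 0ℚ → x ≡ 0ℤ
  ℤ→ℚ-zero x eq with ℚᵘ.≃-trans (ℚᵘ.≃-sym (toᵘ x)) (ℚᵘ.≃-reflexive (cong ℚ.toℚᵘ eq))
  ... | *≡* e = trans (sym (ℤ.*-identityʳ x)) e

fromℤ-0 : fromℤ 0ℤ ≈ᴿ fromℚ 0ℚ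
fromℤ-0 = pointwise (λ _ → refl)

fromℤ-1 : fromℤ 1ℤ ≈ᴿ fromℚ 1ℚ
fromℤ-1 = pointwise (λ _ → refl)

fromℤ-+ : ∀ x y → fromℤ (x ℤ.+ y) ≈ᴿ (fromℤ x +ᴿ fromℤ y)
fromℤ-+ x y = pointwise (λ _ → ℤ→ℚ-+ x y)

fromℤ-* : ∀ x y → fromℤ (x ℤ.* y) ≈ᴿ (fromℤ x *ᴿ fromℤ y)
fromℤ-* x y = pointwise (λ _ → ℤ→ℚ-* x y)

fromℤ-zero : ∀ x → fromℤ x ≈ᴿ fromℚ 0ℚ → x ≡ 0ℤ
fromℤ-zero x e with ℤ→ℚ x ℚ.≟ 0ℚ
... | yes eq = ℤ→ℚ-zero x eq
... | no  ne = contradiction (subst (ℚ._< d) dist (proj₂ lim (proj₁ lim) ℕ.≤-refl)) (ℚ.<-irrefl refl)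
  where
  d : ℚ
  d = ℚ.∣ ℤ→ℚ x ∣
  d>0 : 0ℚ ℚ.< d
  d>0 = ℚ.positive⁻¹ d {{ℚ.nonNeg∧nonZero⇒pos d {{ℚ.∣-∣-nonNeg (ℤ→ℚ x)}}
          {{ℚ.≢-nonZero (λ z → ne (ℚ.∣p∣≡0⇒p≡0 (ℤ→ℚ x) z))}}}}
  lim : ∃[ N ] (∀ p → N ℕ.≤ p → ℚ.∣ ℤ→ℚ x ℚ.- 0ℚ ∣ ℚ.< d)
  lim = close e d d>0
  dist : ℚ.∣ ℤ→ℚ x ℚ.- 0ℚ ∣ ≡ d
  dist = cong ℚ.∣_∣ (ℚ.+-identityʳ (ℤ→ℚ x))

fromℤ-inv : ∀ x → 0ℤ ℤ.< x → ∃[ u ] (u *ᴿ fromℤ x) ≈ᴿ fromℚ 1ℚ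
fromℤ-inv x x>0 = fromℚ (ℚ.1/ ℤ→ℚ x) , pointwise (λ _ → ℚ.*-inverseˡ (ℤ→ℚ x))
  where
  instance
    nz : ℚ.NonZero (ℤ→ℚ x)
    nz = ℚ.≢-nonZero (λ eq → ℤ.<-irrefl (sym (ℤ→ℚ-zero x eq)) x>0)

module Σℤ = SemiringSum ℤ.+-*-semiring

ℤ^_ : ℕ → Set
ℤ^ n = Vector ℤ n

negate : ∀ {n} → ℤ^ n → ℤ^ n
negate v l = ℤ.- v l

-- Used below only with K = ℝ and ι = fromℤ. The development is kept generic because it
-- needs nothing about ℝ beyond the parameters of the module Existence.
module Lattice (K : CommutativeRing 0ℓ 0ℓ) (ι : ℤ → CommutativeRing.Carrier K) where

  module K = CommutativeRing K
  open K using (_≈_; 0#; 1#)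
  module ΣK = SemiringSum K.semiring

  Combᴷ : ∀ {n k} → Vector K.Carrier k → Vector (ℤ^ n) k → ℤ^ n → Set
  Combᴷ c v x = ∀ l → ι (x l) ≈ ΣK.sum (λ i → c i K.* ι (v i l))

  Indepᴷ : ∀ {n k} → Vector (ℤ^ n) k → Set
  Indepᴷ {n} {k} v = ∀ (c : Vector K.Carrier k) → (∀ l → ΣK.sum (λ i → c i K.* ι (v i l)) ≈ 0#) → ∀ i → c i ≈ 0#

  -- ℤⁿ ∩ span_K(v₁, …, v_k)
  Γ : ∀ {n k} → Vector (ℤ^ n) k → Pred (ℤ^ n) 0ℓ
  Γ v x = ∃[ c ] Combᴷ c v x

  Combℤ : ∀ {n k} → Vector ℤ k → Vector (ℤ^ n) k → ℤ^ n → Set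
  Combℤ c v x = ∀ l → x l ≡ Σℤ.sum (λ i → c i ℤ.* v i l)

  Spanℤ : ∀ {n k} → Vector (ℤ^ n) k → Pred (ℤ^ n) 0ℓ
  Spanℤ v x = ∃[ c ] Combℤ c v x

  Indepℤ : ∀ {n k} → Vector (ℤ^ n) k → Set
  Indepℤ {n} {k} v = ∀ (m : Vector ℤ k) → (∀ l → Σℤ.sum (λ i → m i ℤ.* v i l) ≡ 0ℤ) → ∀ i → m i ≡ 0ℤ

  record IsBasis {n k} (e : Vector (ℤ^ n) k) (G : Pred (ℤ^ n) 0ℓ) : Set where
    field
      member      : ∀ i → e i ∈ G
      spanning    : ∀ x → x ∈ G → x ∈ Spanℤ e
      independent : Indepℤ e

  -- The basis e of Γ with vᵢ = ∑_{j ≤ i} a j i · eⱼ. The array a is total, so the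
  -- condition that only j ≤ i occur is the field upper.
  record HermiteBasis {n k} (v : Vector (ℤ^ n) k) : Set where
    field
      e        : Vector (ℤ^ n) k
      basis    : IsBasis e (Γ v)
      a        : Fin k → Fin k → ℤ
      expand   : ∀ i → Combℤ (λ j → a j i) e (v i)
      upper    : ∀ j i → i Fin.< j → a j i ≡ 0ℤ
      positive : ∀ i → 0ℤ ℤ.< a i i
      reduced  : ∀ j i → j Fin.< i → 0ℤ ℤ.≤ a j i × a j i ℤ.< a i i

  -- Every K-independent family of integer vectors has a Hermite basis: an automorphism of
  -- ℤⁿ moves v₁ to a positive multiple of the first unit vector; the remaining vectors,
  -- with first coordinate dropped, have a Hermite basis by induction; lift it back and
  -- reduce the new first row.
  module Existence
    (ι-0 : ι 0ℤ ≈ 0#) (ι-1 : ι 1ℤ ≈ 1#)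
    (ι-+ : ∀ x y → ι (x ℤ.+ y) ≈ ι x K.+ ι y)
    (ι-* : ∀ x y → ι (x ℤ.* y) ≈ ι x K.* ι y)
    (ι-zero : ∀ x → ι x ≈ 0# → x ≡ 0ℤ)
    (ι-inv : ∀ x → 0ℤ ℤ.< x → ∃[ u ] u K.* ι x ≈ 1#)
    where

    module KP = Algebra.Properties.Ring K.ring
    open import Relation.Binary.Reasoning.Setoid K.setoid

    ι-cong : ∀ {x y} → x ≡ y → ι x ≈ ι y
    ι-cong refl = K.refl

    ι-injective : ∀ x y → ι x ≈ ι y → x ≡ y
    ι-injective x y eq = ℤ.i-j≡0⇒i≡j x y (ι-zero _ (begin
      ι (x ℤ.- y)            ≈⟨ ι-+ x (ℤ.- y) ⟩
      ι x K.+ ι (ℤ.- y)      ≈⟨ K.+-congʳ eq ⟩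
      ι y K.+ ι (ℤ.- y)      ≈⟨ ι-+ y (ℤ.- y) ⟨
      ι (y ℤ.- y)            ≈⟨ ι-cong (ℤ.+-inverseʳ y) ⟩
      ι 0ℤ                   ≈⟨ ι-0 ⟩
      0#                     ∎))

    ι-sum : ∀ {k} (f : Vector ℤ k) → ι (Σℤ.sum f) ≈ ΣK.sum (ι ∘ f)
    ι-sum {zero}  f = ι-0
    ι-sum {suc k} f = K.trans (ι-+ _ _) (K.+-congˡ (ι-sum (f ∘ suc)))

    ι-comb : ∀ {k} (m x : Vector ℤ k) →
             ι (Σℤ.sum (λ i → m i ℤ.* x i)) ≈ ΣK.sum (λ i → ι (m i) K.* ι (x i))
    ι-comb m x = K.trans (ι-sum (λ i → m i ℤ.* x i)) (ΣK.sum-cong-≋ (λ i → ι-* (m i) (x i)))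

    toK : ∀ {n k} (m : Vector ℤ k) (v : Vector (ℤ^ n) k) x → Combℤ m v x → Combᴷ (ι ∘ m) v x
    toK m v x eq l = K.trans (ι-cong (eq l)) (ι-comb m (λ i → v i l))

    fromK : ∀ {n k} (m : Vector ℤ k) (v : Vector (ℤ^ n) k) x → Combᴷ (ι ∘ m) v x → Combℤ m v x
    fromK m v x eq l = ι-injective _ _ (K.trans (eq l) (K.sym (ι-comb m (λ i → v i l))))

    Combᴷ-cong : ∀ {n k} (c : Vector K.Carrier k) (v w : Vector (ℤ^ n) k) x y →
                 (∀ i → v i ≗ w i) → x ≗ y → Combᴷ c v x → Combᴷ c w y
    Combᴷ-cong c v w x y v≗w x≗y eq l = begin
      ι (y l)                              ≈⟨ ι-cong (x≗y l) ⟨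
      ι (x l)                              ≈⟨ eq l ⟩
      ΣK.sum (λ i → c i K.* ι (v i l))     ≈⟨ ΣK.sum-cong-≋ (λ i → K.*-congˡ (ι-cong (v≗w i l))) ⟩
      ΣK.sum (λ i → c i K.* ι (w i l))     ∎

    sumK-0 : ∀ {k} (f : Vector K.Carrier k) → (∀ i → f i ≈ 0#) → ΣK.sum f ≈ 0#
    sumK-0 {zero} f z = K.refl
    sumK-0 {suc k} f z = K.trans (K.+-cong (z zero) (sumK-0 (f ∘ suc) (z ∘ suc))) (K.+-identityˡ 0#)

    sumℤ-0 : ∀ {k} (f : Vector ℤ k) → (∀ i → f i ≡ 0ℤ) → Σℤ.sum f ≡ 0ℤ
    sumℤ-0 {zero} f z = refl
    sumℤ-0 {suc k} f z = cong₂ ℤ._+_ (z zero) (sumℤ-0 (f ∘ suc) (z ∘ suc))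

    -- Linearity of f, in the form of preserving all K-linear relations.
    Preserves : ∀ {n} → (ℤ^ n → ℤ^ n) → Set
    Preserves {n} f = ∀ {k} (c : Vector K.Carrier k) v x → Combᴷ c v x → Combᴷ c (f ∘ v) (f x)

    record Aut (n : ℕ) : Set where
      field
        to from   : ℤ^ n → ℤ^ n
        to-from   : ∀ x → to (from x) ≗ x
        from-to   : ∀ x → from (to x) ≗ x
        to-pres   : Preserves to
        from-pres : Preserves from

    pres-0 : ∀ {n} (f : ℤ^ n → ℤ^ n) → Preserves f → ∀ x → (∀ l → x l ≡ 0ℤ) → ∀ l → f x l ≡ 0ℤ
    pres-0 f p x x0 l = ι-zero _ (p {k = 0} (λ ()) (λ ()) x (λ l → K.trans (ι-cong (x0 l)) ι-0) l)

    pres-≗ : ∀ {n} (f : ℤ^ n → ℤ^ n) → Preserves f → ∀ x y → x ≗ y → f x ≗ f y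
    pres-≗ f p x y x≗y l = ι-injective _ _ (K.trans (p {k = 1} (λ _ → 1#) (λ _ → y) x
      (λ l → K.trans (ι-cong (x≗y l)) (K.sym (one _))) l) (one _))
      where
      one : ∀ t → 1# K.* t K.+ 0# ≈ t
      one t = K.trans (K.+-identityʳ _) (K.*-identityˡ t)

    idAut : ∀ {n} → Aut n
    idAut = record { to = λ x → x ; from = λ x → x ; to-from = λ _ _ → refl ; from-to = λ _ _ → refl
                   ; to-pres = λ _ _ _ p → p ; from-pres = λ _ _ _ p → p }

    infixr 9 _∙_
    _∙_ : ∀ {n} → Aut n → Aut n → Aut n
    φ ∙ ψ = record
      { to = φ.to ∘ ψ.to ; from = ψ.from ∘ φ.from
      ; to-from = λ x l → trans (pres-≗ φ.to φ.to-pres _ _ (ψ.to-from (φ.from x)) l) (φ.to-from x l)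
      ; from-to = λ x l → trans (pres-≗ ψ.from ψ.from-pres _ _ (φ.from-to (ψ.to x)) l) (ψ.from-to x l)
      ; to-pres = λ c v x p → φ.to-pres c _ _ (ψ.to-pres c v x p)
      ; from-pres = λ c v x p → ψ.from-pres c _ _ (φ.from-pres c v x p) }
      where
      module φ = Aut φ
      module ψ = Aut ψ

    liftAut : ∀ {n} → Aut n → Aut (suc n)
    liftAut {n} φ = record
      { to = lift φ.to ; from = lift φ.from
      ; to-from = λ { x zero → refl ; x (suc l) → φ.to-from (tail x) l }
      ; from-to = λ { x zero → refl ; x (suc l) → φ.from-to (tail x) l }
      ; to-pres = pres φ.to φ.to-pres
      ; from-pres = pres φ.from φ.from-pres }
      where
      module φ = Aut φ
      lift : (ℤ^ n → ℤ^ n) → ℤ^ (suc n) → ℤ^ (suc n)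
      lift f x zero    = x zero
      lift f x (suc l) = f (tail x) l
      pres : ∀ f → Preserves f → Preserves (lift f)
      pres f p c v x eq zero    = eq zero
      pres f p c v x eq (suc l) = p c (tail ∘ v) (tail x) (eq ∘ suc) l

    -- (x₀, x₁) ↦ (r x₀ + s x₁, t x₀ + w x₁)
    mix : ∀ {n} (r s t w : ℤ) → ℤ^ (suc (suc n)) → ℤ^ (suc (suc n))
    mix r s t w x zero          = r ℤ.* x zero ℤ.+ s ℤ.* x (suc zero)
    mix r s t w x (suc zero)    = t ℤ.* x zero ℤ.+ w ℤ.* x (suc zero)
    mix r s t w x (suc (suc l)) = x (suc (suc l))

    lin2 : ∀ {k} r s (c : Vector K.Carrier k) (p q : Vector ℤ k) x y →
           ι x ≈ ΣK.sum (λ i → c i K.* ι (p i)) → ι y ≈ ΣK.sum (λ i → c i K.* ι (q i)) →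
           ι (r ℤ.* x ℤ.+ s ℤ.* y) ≈ ΣK.sum (λ i → c i K.* ι (r ℤ.* p i ℤ.+ s ℤ.* q i))
    lin2 r s c p q x y ex ey = begin
      ι (r ℤ.* x ℤ.+ s ℤ.* y)
        ≈⟨ lin r s x y ⟩
      ι r K.* ι x K.+ ι s K.* ι y
        ≈⟨ K.+-cong (K.*-congˡ ex) (K.*-congˡ ey) ⟩
      ι r K.* ΣK.sum (λ i → c i K.* ι (p i)) K.+ ι s K.* ΣK.sum (λ i → c i K.* ι (q i))
        ≈⟨ K.+-cong (ΣK.*-distribˡ-sum (ι r) (λ i → c i K.* ι (p i)))
                    (ΣK.*-distribˡ-sum (ι s) (λ i → c i K.* ι (q i))) ⟩
      ΣK.sum (λ i → ι r K.* (c i K.* ι (p i))) K.+ ΣK.sum (λ i → ι s K.* (c i K.* ι (q i)))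
        ≈⟨ ΣK.∑-distrib-+ (λ i → ι r K.* (c i K.* ι (p i))) (λ i → ι s K.* (c i K.* ι (q i))) ⟨
      ΣK.sum (λ i → ι r K.* (c i K.* ι (p i)) K.+ ι s K.* (c i K.* ι (q i)))
        ≈⟨ ΣK.sum-cong-≋ (λ i → K.trans (arr (ι r) (ι s) (c i) (ι (p i)) (ι (q i)))
                                         (K.*-congˡ (K.sym (lin r s (p i) (q i))))) ⟩
      ΣK.sum (λ i → c i K.* ι (r ℤ.* p i ℤ.+ s ℤ.* q i)) ∎
      where
      lin : ∀ r s x y → ι (r ℤ.* x ℤ.+ s ℤ.* y) ≈ ι r K.* ι x K.+ ι s K.* ι y
      lin r s x y = K.trans (ι-+ _ _) (K.+-cong (ι-* r x) (ι-* s y))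
      arr : ∀ r s c p q → r K.* (c K.* p) K.+ s K.* (c K.* q) ≈ c K.* (r K.* p K.+ s K.* q)
      arr r s c p q = K.trans (K.+-cong (swap r c p) (swap s c q)) (K.sym (K.distribˡ c (r K.* p) (s K.* q)))
        where
        swap : ∀ r c p → r K.* (c K.* p) ≈ c K.* (r K.* p)
        swap r c p = K.trans (K.sym (K.*-assoc r c p))
                       (K.trans (K.*-congʳ (K.*-comm r c)) (K.*-assoc c r p))

    mix-pres : ∀ {n} r s t w → Preserves (mix {n} r s t w)
    mix-pres r s t w c v x eq zero          = lin2 r s c (λ i → v i zero) (λ i → v i (suc zero)) (x zero) (x (suc zero)) (eq zero) (eq (suc zero))
    mix-pres r s t w c v x eq (suc zero)    = lin2 t w c (λ i → v i zero) (λ i → v i (suc zero)) (x zero) (x (suc zero)) (eq zero) (eq (suc zero))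
    mix-pres r s t w c v x eq (suc (suc l)) = eq (suc (suc l))

    mixAut : ∀ {n} (x y p q : ℤ) → x ℤ.* p ℤ.+ y ℤ.* q ≡ 1ℤ → Aut (suc (suc n))
    mixAut x y p q det = record
      { to = mix x y (ℤ.- q) p ; from = mix p (ℤ.- y) q x
      ; to-from = λ { u zero       → one _ (u zero) (tf0 x y p q (u zero) (u (suc zero)))
                    ; u (suc zero) → one _ (u (suc zero)) (tf1 x y p q (u zero) (u (suc zero)))
                    ; u (suc (suc l)) → refl }
      ; from-to = λ { u zero       → one _ (u zero) (ft0 x y p q (u zero) (u (suc zero)))
                    ; u (suc zero) → one _ (u (suc zero)) (ft1 x y p q (u zero) (u (suc zero)))
                    ; u (suc (suc l)) → refl }
      ; to-pres = mix-pres x y (ℤ.- q) p ; from-pres = mix-pres p (ℤ.- y) q x }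
      where
      one : ∀ z u → z ≡ (x ℤ.* p ℤ.+ y ℤ.* q) ℤ.* u → z ≡ u
      one z u eq = trans eq (trans (cong (λ t → t ℤ.* u) det) (ℤ.*-identityˡ u))
      tf0 : ∀ x y p q u v → x ℤ.* (p ℤ.* u ℤ.+ ℤ.- y ℤ.* v) ℤ.+ y ℤ.* (q ℤ.* u ℤ.+ x ℤ.* v)
            ≡ (x ℤ.* p ℤ.+ y ℤ.* q) ℤ.* u
      tf0 = ℤ-solve
      tf1 : ∀ x y p q u v → ℤ.- q ℤ.* (p ℤ.* u ℤ.+ ℤ.- y ℤ.* v) ℤ.+ p ℤ.* (q ℤ.* u ℤ.+ x ℤ.* v)
            ≡ (x ℤ.* p ℤ.+ y ℤ.* q) ℤ.* v
      tf1 = ℤ-solve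
      ft0 : ∀ x y p q u v → p ℤ.* (x ℤ.* u ℤ.+ y ℤ.* v) ℤ.+ ℤ.- y ℤ.* (ℤ.- q ℤ.* u ℤ.+ p ℤ.* v)
            ≡ (x ℤ.* p ℤ.+ y ℤ.* q) ℤ.* u
      ft0 = ℤ-solve
      ft1 : ∀ x y p q u v → q ℤ.* (x ℤ.* u ℤ.+ y ℤ.* v) ℤ.+ x ℤ.* (ℤ.- q ℤ.* u ℤ.+ p ℤ.* v)
            ≡ (x ℤ.* p ℤ.+ y ℤ.* q) ℤ.* v
      ft1 = ℤ-solve

    signed : ∀ a → ∃[ s ] a ≡ s ℤ.* + ℤ.∣ a ∣ × s ℤ.* s ≡ 1ℤ
    signed a with ℤ.+∣i∣≡i⊎+∣i∣≡-i a
    ... | inj₁ eq = 1ℤ , trans (sym eq) (sym (ℤ.*-identityˡ (+ ℤ.∣ a ∣))) , refl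
    ... | inj₂ eq = -1ℤ , trans (sym (ℤ.neg-involutive a))
                            (trans (cong ℤ.-_ (sym eq)) (sym (ℤ.-1*i≡-i (+ ℤ.∣ a ∣)))) , refl

    Bez : ℤ → ℤ → Set
    Bez a b = ∃[ d ] ∃[ p ] ∃[ q ] ∃[ x ] ∃[ y ]
      x ℤ.* p ℤ.+ y ℤ.* q ≡ 1ℤ × a ≡ p ℤ.* + d × b ≡ q ℤ.* + d

    bezℕ : ∀ a b → Bez (+ a) (+ b)
    bezℕ a b with Bézout.lemma a b
    ... | Bézout.result zero g _ with GCD.GCD.commonDivisor g
    ...   | divides p ep , divides q eq =
      0 , 1ℤ , 0ℤ , 1ℤ , 0ℤ , refl
        , cong +_ (trans ep (ℕ.*-zeroʳ p)) , cong +_ (trans eq (ℕ.*-zeroʳ q))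
    bezℕ a b | Bézout.result d@(suc d-1) g id with GCD.GCD.commonDivisor g
    ...   | divides p ep , divides q eq = go id
      where
      ap : + a ≡ + p ℤ.* + d
      ap = trans (cong +_ ep) (ℤ.pos-* p d)
      bq : + b ≡ + q ℤ.* + d
      bq = trans (cong +_ eq) (ℤ.pos-* q d)
      pos : ∀ u v w t → d ℕ.+ u ℕ.* v ≡ w ℕ.* t → + d ℤ.+ + u ℤ.* + v ≡ + w ℤ.* + t
      pos u v w t e = trans (cong (ℤ._+_ (+ d)) (sym (ℤ.pos-* u v)))
                        (trans (cong +_ e) (ℤ.pos-* w t))
      fin : ∀ x y → x ℤ.* + a ℤ.+ y ℤ.* + b ≡ + d → Bez (+ a) (+ b)
      fin x y e = d , + p , + q , x , y , ℤ.*-cancelʳ-≡ (x ℤ.* + p ℤ.+ y ℤ.* + q) 1ℤ (+ d) (trans (r1 x y (+ p) (+ q) (+ d))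
          (trans (cong₂ (λ s t → x ℤ.* s ℤ.+ y ℤ.* t) (sym ap) (sym bq))
            (trans e (sym (ℤ.*-identityˡ (+ d)))))) , ap , bq
        where
        r1 : ∀ x y p q d → (x ℤ.* p ℤ.+ y ℤ.* q) ℤ.* d ≡ x ℤ.* (p ℤ.* d) ℤ.+ y ℤ.* (q ℤ.* d)
        r1 = ℤ-solve
      r2 : ∀ d u v w t → d ℤ.+ u ℤ.* v ≡ w ℤ.* t → w ℤ.* t ℤ.+ ℤ.- u ℤ.* v ≡ d
      r2 d u v w t e = trans (cong (λ t → t ℤ.+ (ℤ.- u ℤ.* v)) (sym e)) (r3 d u v)
        where
        r3 : ∀ d u v → d ℤ.+ u ℤ.* v ℤ.+ ℤ.- u ℤ.* v ≡ d
        r3 = ℤ-solve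
      go : Bézout.Identity d a b → Bez (+ a) (+ b)
      go (Bézout.+- x y e) = fin (+ x) (ℤ.- + y) (r2 (+ d) (+ y) (+ b) (+ x) (+ a) (pos y b x a e))
      go (Bézout.-+ x y e) = fin (ℤ.- + x) (+ y) (trans (ℤ.+-comm (ℤ.- + x ℤ.* + a) (+ y ℤ.* + b))
                               (r2 (+ d) (+ x) (+ a) (+ y) (+ b) (pos x a y b e)))

    bez : ∀ a b → Bez a b
    bez a b with signed a | signed b | bezℕ ℤ.∣ a ∣ ℤ.∣ b ∣
    ... | s , es , ss | t , et , tt | d , p , q , x , y , det , ep , eq =
      d , s ℤ.* p , t ℤ.* q , s ℤ.* x , t ℤ.* y
        , trans (r1 s t p q x y) (trans (cong₂ (λ u v → u ℤ.* (x ℤ.* p) ℤ.+ v ℤ.* (y ℤ.* q)) ss tt)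
            (trans (cong₂ ℤ._+_ (ℤ.*-identityˡ (x ℤ.* p)) (ℤ.*-identityˡ (y ℤ.* q))) det))
        , trans es (trans (cong (λ t → s ℤ.* t) ep) (sym (ℤ.*-assoc s p (+ d))))
        , trans et (trans (cong (λ z → t ℤ.* z) eq) (sym (ℤ.*-assoc t q (+ d))))
      where
      r1 : ∀ s t p q x y → (s ℤ.* x) ℤ.* (s ℤ.* p) ℤ.+ (t ℤ.* y) ℤ.* (t ℤ.* q)
           ≡ (s ℤ.* s) ℤ.* (x ℤ.* p) ℤ.+ (t ℤ.* t) ℤ.* (y ℤ.* q)
      r1 = ℤ-solve

    scale1 : ∀ s → s ℤ.* s ≡ 1ℤ → Aut 1
    scale1 s ss = record
      { to = f ; from = f ; to-from = inv ; from-to = inv ; to-pres = pres ; from-pres = pres }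
      where
      f : ℤ^ 1 → ℤ^ 1
      f x l = s ℤ.* x l ℤ.+ 0ℤ ℤ.* x l
      r1 : ∀ s x → s ℤ.* (s ℤ.* x ℤ.+ 0ℤ ℤ.* x) ℤ.+ 0ℤ ℤ.* (s ℤ.* x ℤ.+ 0ℤ ℤ.* x) ≡ s ℤ.* s ℤ.* x
      r1 = ℤ-solve
      inv : ∀ x → f (f x) ≗ x
      inv x l = trans (r1 s (x l)) (trans (cong (λ t → t ℤ.* x l) ss) (ℤ.*-identityˡ (x l)))
      pres : Preserves f
      pres c v x eq l = lin2 s 0ℤ c (λ i → v i l) (λ i → v i l) (x l) (x l) (eq l) (eq l)

    record ToFirst {n} (u : ℤ^ (suc n)) : Set where
      field
        aut  : Aut (suc n)
        d    : ℕ
        top  : Aut.to aut u zero ≡ + d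
        rest : ∀ l → Aut.to aut u (suc l) ≡ 0ℤ

    toFirst₁ : (u : ℤ^ 1) (s : ℤ) → u zero ≡ s ℤ.* + ℤ.∣ u zero ∣ → s ℤ.* s ≡ 1ℤ → ToFirst u
    toFirst₁ u s es ss = record
      { aut = scale1 s ss ; d = ℤ.∣ u zero ∣ ; rest = λ ()
      ; top = trans (cong (λ t → s ℤ.* t ℤ.+ 0ℤ ℤ.* t) es)
                (trans (r1 s A) (trans (cong (λ t → t ℤ.* A) ss) (ℤ.*-identityˡ A))) }
      where
      A : ℤ
      A = + ℤ.∣ u zero ∣
      r1 : ∀ s x → s ℤ.* (s ℤ.* x) ℤ.+ 0ℤ ℤ.* (s ℤ.* x) ≡ s ℤ.* s ℤ.* x
      r1 = ℤ-solve

    toFirst₊ : ∀ {n} (u : ℤ^ (suc (suc n))) (F : ToFirst (tail u)) →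
               Bez (u zero) (+ ToFirst.d F) → ToFirst u
    toFirst₊ u F (d , p , q , x , y , det , ep , eq) = record
      { aut  = mixAut x y p q det ∙ liftAut F.aut
      ; d    = d
      ; top  = trans (cong₂ (λ s t → x ℤ.* s ℤ.+ y ℤ.* t) ep (trans F.top eq))
                 (trans (r1 x y p q (+ d)) (trans (cong (λ t → t ℤ.* + d) det) (ℤ.*-identityˡ (+ d))))
      ; rest = λ { zero → trans (cong₂ (λ s t → ℤ.- q ℤ.* s ℤ.+ p ℤ.* t) ep (trans F.top eq)) (r2 p q (+ d))
                 ; (suc l) → F.rest l } }
      where
      module F = ToFirst F
      r1 : ∀ x y p q d → x ℤ.* (p ℤ.* d) ℤ.+ y ℤ.* (q ℤ.* d) ≡ (x ℤ.* p ℤ.+ y ℤ.* q) ℤ.* d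
      r1 = ℤ-solve
      r2 : ∀ p q d → ℤ.- q ℤ.* (p ℤ.* d) ℤ.+ p ℤ.* (q ℤ.* d) ≡ 0ℤ
      r2 = ℤ-solve

    toFirst : ∀ n (u : ℤ^ (suc n)) → ToFirst u
    toFirst zero u with s , es , ss ← signed (u zero) = toFirst₁ u s es ss
    toFirst (suc n) u = toFirst₊ u F (bez (u zero) (+ ToFirst.d F))
      where
      F : ToFirst (tail u)
      F = toFirst n (tail u)

    transport : ∀ {n k} (φ : Aut n) (v : Vector (ℤ^ n) k) →
                HermiteBasis (Aut.to φ ∘ v) → HermiteBasis v
    transport {n} {k} φ v H = record
      { e = e ; a = H.a ; upper = H.upper ; positive = H.positive ; reduced = H.reduced
      ; basis = isBasis
      ; expand = λ i → back (λ j → H.a j i) (v i) (H.expand i) }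
      where
      module H = HermiteBasis H
      module B = IsBasis H.basis
      open Aut φ
      e : Vector (ℤ^ n) k
      e = from ∘ H.e
      back : ∀ m x → Combℤ m H.e (to x) → Combℤ m e x
      back m x eq = fromK m e x (Combᴷ-cong (ι ∘ m) e e _ x (λ _ _ → refl) (from-to x)
                      (from-pres (ι ∘ m) H.e (to x) (toK m H.e (to x) eq)))
      mem : ∀ i → Γ v (e i)
      mem i with B.member i
      ... | c , p = c , Combᴷ-cong c _ v _ (e i) (λ j → from-to (v j)) (λ _ → refl)
                          (from-pres c (to ∘ v) (H.e i) p)
      span : ∀ x → Γ v x → Spanℤ e x
      span x (c , p) with B.spanning (to x) (c , to-pres c v x p)
      ... | m , q = m , back m x q
      ind : Indepℤ e
      ind m z = B.independent m λ l → trans (sym (fwd l)) (pres-0 to to-pres _ (λ _ → refl) l)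
        where
        fwd : Combℤ m H.e (to (λ _ → 0ℤ))
        fwd = fromK m H.e _ (Combᴷ-cong (ι ∘ m) _ H.e _ _ (λ j → to-from (H.e j)) (λ _ → refl)
                (to-pres (ι ∘ m) e (λ _ → 0ℤ) (toK m e (λ _ → 0ℤ) (λ l → sym (z l)))))

      isBasis : IsBasis e (Γ v)
      isBasis = record { member = mem ; spanning = span ; independent = ind }

    transportIndep : ∀ {n k} (φ : Aut n) (v : Vector (ℤ^ n) k) → Indepᴷ v → Indepᴷ (Aut.to φ ∘ v)
    transportIndep φ v ind c z = ind c λ l → K.trans (K.sym
      (Combᴷ-cong c _ v _ (λ _ → 0ℤ) (λ j → from-to (v j)) (pres-0 from from-pres _ (λ _ → refl))
        (from-pres c (to ∘ v) (λ _ → 0ℤ) (λ l → K.trans ι-0 (K.sym (z l)))) l)) ι-0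
      where open Aut φ

    divide : ∀ h d → 0ℤ ℤ.< d → ∃[ c ] 0ℤ ℤ.≤ h ℤ.- d ℤ.* c × h ℤ.- d ℤ.* c ℤ.< d
    divide h d@(+ suc _) _ = h ℤ./ d , subst (0ℤ ℤ.≤_) (sym eq) (ℤ.+≤+ ℕ.z≤n)
                             , subst (ℤ._< d) (sym eq) (ℤ.+<+ (ℤ.n%d<d h d))
      where
      r1 : ∀ r q d → (r ℤ.+ q ℤ.* d) ℤ.- d ℤ.* q ≡ r
      r1 = ℤ-solve
      eq : h ℤ.- d ℤ.* (h ℤ./ d) ≡ + (h ℤ.% d)
      eq = trans (cong (λ t → t ℤ.- d ℤ.* (h ℤ./ d)) (ℤ.a≡a%n+[a/n]*n h d)) (r1 (+ (h ℤ.% d)) (h ℤ./ d) d)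
    divide h (+ zero) (ℤ.+<+ ())

    reduce : ∀ {k} (a : Fin k → Fin k → ℤ) → (∀ j i → i Fin.< j → a j i ≡ 0ℤ) →
             (∀ i → 0ℤ ℤ.< a i i) → (h : Vector ℤ k) → Σ (Vector ℤ k) λ c → (∀ i →
             let r = h i ℤ.- Σℤ.sum (λ j → a j i ℤ.* c j) in 0ℤ ℤ.≤ r × r ℤ.< a i i)
    reduce {zero} a up pos h = (λ ()) , λ ()
    reduce {suc k} a up pos h with divide (h zero) (a zero zero) (pos zero)
    ... | c₀ , lo , hi with reduce (λ j i → a (suc j) (suc i)) (λ j i i<j → up (suc j) (suc i) (ℕ.s≤s i<j)) (pos ∘ suc)
                              (λ i → h (suc i) ℤ.- a zero (suc i) ℤ.* c₀)
    ...   | c , p = c′ , q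
      where
      c′ : Vector ℤ (suc k)
      c′ = c₀ ∷ c
      r1 : ∀ h x s → h ℤ.- x ℤ.- s ≡ h ℤ.- (x ℤ.+ s)
      r1 = ℤ-solve
      e0 : h zero ℤ.- a zero zero ℤ.* c₀ ≡ h zero ℤ.- Σℤ.sum (λ j → a j zero ℤ.* c′ j)
      e0 = cong (λ t → h zero ℤ.- t) (trans (sym (ℤ.+-identityʳ (a zero zero ℤ.* c₀))) (cong (λ t → a zero zero ℤ.* c₀ ℤ.+ t)
             (sym (sumℤ-0 (λ j → a (suc j) zero ℤ.* c j)
               (λ j → trans (cong (λ t → t ℤ.* c j) (up (suc j) zero (ℕ.s≤s ℕ.z≤n))) (ℤ.*-zeroˡ (c j)))))))
      q : ∀ i → let r = h i ℤ.- Σℤ.sum (λ j → a j i ℤ.* c′ j) in 0ℤ ℤ.≤ r × r ℤ.< a i i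
      q zero    = subst (λ r → 0ℤ ℤ.≤ r × r ℤ.< a zero zero) e0 (lo , hi)
      q (suc i) = subst (λ r → 0ℤ ℤ.≤ r × r ℤ.< a (suc i) (suc i)) (r1 (h (suc i)) (a zero (suc i) ℤ.* c₀) (Σℤ.sum (λ j → a (suc j) (suc i) ℤ.* c j))) (p i)

    first : ∀ x s → x ≡ (x ℤ.- s) ℤ.* 1ℤ ℤ.+ s
    first = ℤ-solve

    dropℤ : ∀ m s → s ≡ m ℤ.* 0ℤ ℤ.+ s
    dropℤ = ℤ-solve

    unit : ∀ g → g ≡ g ℤ.* 1ℤ ℤ.+ 0ℤ
    unit = ℤ-solve

    module Step {n k} (v : Vector (ℤ^ (suc n)) (suc k)) (pos : 0ℤ ℤ.< v zero zero)
                (col : ∀ l → v zero (suc l) ≡ 0ℤ) (ind : Indepᴷ v) where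

      g : ℤ
      g = v zero zero

      u : K.Carrier
      u = proj₁ (ι-inv g pos)

      ug : u K.* ι g ≈ 1#
      ug = proj₂ (ι-inv g pos)

      w : Vector (ℤ^ n) k
      w i = tail (v (suc i))

      drop : ∀ (c₀ : K.Carrier) l s → c₀ K.* ι (v zero (suc l)) K.+ s ≈ s
      drop c₀ l s = begin
        c₀ K.* ι (v zero (suc l)) K.+ s ≈⟨ K.+-congʳ (K.*-congˡ (K.trans (ι-cong (col l)) ι-0)) ⟩
        c₀ K.* 0# K.+ s                 ≈⟨ K.+-congʳ (K.zeroʳ c₀) ⟩
        0# K.+ s                        ≈⟨ K.+-identityˡ s ⟩
        s                               ∎

      solve₀ : ∀ t s → u K.* (t K.- s) K.* ι g K.+ s ≈ t
      solve₀ t s = begin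
        u K.* (t K.- s) K.* ι g K.+ s   ≈⟨ r1 u t s (ι g) ⟩
        u K.* ι g K.* (t K.- s) K.+ s   ≈⟨ K.+-congʳ (K.trans (K.*-congʳ ug) (K.*-identityˡ _)) ⟩
        t K.- s K.+ s                   ≈⟨ r2 t s ⟩
        t                               ∎
        where
        r1 : ∀ u t s g → u K.* (t K.- s) K.* g K.+ s ≈ u K.* g K.* (t K.- s) K.+ s
        r1 u t s g = K.+-congʳ (K.trans (K.*-assoc u (t K.- s) g)
                       (K.trans (K.*-congˡ (K.*-comm (t K.- s) g)) (K.sym (K.*-assoc u g (t K.- s)))))
        r2 : ∀ t s → t K.- s K.+ s ≈ t
        r2 t s = K.trans (K.+-assoc t (K.- s) s) (K.trans (K.+-congˡ (K.-‿inverseˡ s)) (K.+-identityʳ t))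

      indep-w : Indepᴷ w
      indep-w c z i = ind c′ z′ (suc i)
        where
        S : K.Carrier
        S = ΣK.sum (λ i → c i K.* ι (v (suc i) zero))
        c′ : Vector K.Carrier (suc k)
        c′ = (u K.* (0# K.- S)) ∷ c
        z′ : ∀ l → ΣK.sum (λ i → c′ i K.* ι (v i l)) ≈ 0#
        z′ zero    = solve₀ 0# S
        z′ (suc l) = K.trans (drop _ l _) (z l)

      module _ (H : HermiteBasis w) where
        module H = HermiteBasis H
        module B = IsBasis H.basis

        red : Σ (Vector ℤ k) λ c → (∀ i → let r = v (suc i) zero ℤ.- Σℤ.sum (λ j → H.a j i ℤ.* c j) in
                      0ℤ ℤ.≤ r × r ℤ.< H.a i i)
        red = reduce H.a H.upper H.positive (λ i → v (suc i) zero)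

        c : Vector ℤ k
        c = proj₁ red

        e : Vector (ℤ^ (suc n)) (suc k)
        e zero zero          = 1ℤ
        e zero (suc l)       = 0ℤ
        e (suc j) zero       = c j
        e (suc j) (suc l)    = H.e j l

        a : Fin (suc k) → Fin (suc k) → ℤ
        a zero zero          = g
        a (suc j) zero       = 0ℤ
        a zero (suc i)       = v (suc i) zero ℤ.- Σℤ.sum (λ j → H.a j i ℤ.* c j)
        a (suc j) (suc i)    = H.a j i

        expand : ∀ i → Combℤ (λ j → a j i) e (v i)
        expand zero zero       = trans (unit g) (cong (λ t → g ℤ.* 1ℤ ℤ.+ t)
                                   (sym (sumℤ-0 (λ j → 0ℤ ℤ.* c j) (λ j → ℤ.*-zeroˡ (c j)))))
        expand zero (suc l)    = trans (col l) (trans (dropℤ g 0ℤ) (cong (λ t → g ℤ.* 0ℤ ℤ.+ t)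
                                   (sym (sumℤ-0 (λ j → 0ℤ ℤ.* H.e j l) (λ j → ℤ.*-zeroˡ (H.e j l))))))
        expand (suc i) zero    = first (v (suc i) zero) (Σℤ.sum (λ j → H.a j i ℤ.* c j))
        expand (suc i) (suc l) = trans (H.expand i l) (dropℤ (a zero (suc i)) (Σℤ.sum (λ j → H.a j i ℤ.* H.e j l)))

        upper : ∀ j i → i Fin.< j → a j i ≡ 0ℤ
        upper zero    i       ()
        upper (suc j) zero    _           = refl
        upper (suc j) (suc i) (ℕ.s≤s i<j) = H.upper j i i<j

        positive : ∀ i → 0ℤ ℤ.< a i i
        positive zero    = pos
        positive (suc i) = H.positive i

        reduced : ∀ j i → j Fin.< i → 0ℤ ℤ.≤ a j i × a j i ℤ.< a i i
        reduced zero    (suc i) _           = proj₂ red i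
        reduced (suc j) (suc i) (ℕ.s≤s j<i) = H.reduced j i j<i

        member : ∀ i → Γ v (e i)
        member zero = (u ∷ λ _ → 0#) , λ
          { zero    → K.trans ι-1 (K.trans (K.sym ug) (rest (u K.* ι g) (λ i → ι (v (suc i) zero))))
          ; (suc l) → K.trans ι-0 (K.trans (K.sym (sumK-0 _ (λ i → K.zeroˡ (ι (v (suc i) (suc l))))))
                        (K.sym (drop u l _))) }
          where
          rest : ∀ s (f : Vector K.Carrier k) → s ≈ s K.+ ΣK.sum (λ i → 0# K.* f i)
          rest s f = K.trans (K.sym (K.+-identityʳ s))
                       (K.+-congˡ (K.sym (sumK-0 _ (λ i → K.zeroˡ (f i)))))
        member (suc j) with B.member j
        ... | μ , p = ((u K.* (ι (c j) K.- S)) ∷ μ) , λ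
          { zero    → K.sym (solve₀ (ι (c j)) S)
          ; (suc l) → K.trans (p l) (K.sym (drop _ l _)) }
          where
          S : K.Carrier
          S = ΣK.sum (λ i → μ i K.* ι (v (suc i) zero))

        spanning : ∀ x → Γ v x → Spanℤ e x
        spanning x (μ , p) with B.spanning (tail x) (μ ∘ suc , λ l → K.trans (p (suc l)) (drop _ l _))
        ... | m , q = ((x zero ℤ.- S) ∷ m) , λ
          { zero    → first (x zero) S
          ; (suc l) → trans (q l) (dropℤ (x zero ℤ.- S) (Σℤ.sum (λ j → m j ℤ.* H.e j l))) }
          where
          S : ℤ
          S = Σℤ.sum (λ j → m j ℤ.* c j)

        independent : Indepℤ e
        independent m z = λ { zero → m₀ ; (suc i) → m₊ i }
          where
          m₊ : ∀ i → m (suc i) ≡ 0ℤ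
          m₊ = B.independent (m ∘ suc) (λ l → trans (dropℤ (m zero) (Σℤ.sum (λ j → m (suc j) ℤ.* H.e j l))) (z (suc l)))
          m₀ : m zero ≡ 0ℤ
          m₀ = trans (unit (m zero)) (trans (cong (λ t → m zero ℤ.* 1ℤ ℤ.+ t) (sym (sumℤ-0 (λ j → m (suc j) ℤ.* c j)
                 (λ j → trans (cong (λ t → t ℤ.* c j) (m₊ j)) (ℤ.*-zeroˡ (c j)))))) (z zero))

        isBasis : IsBasis e (Γ v)
        isBasis = record { member = member ; spanning = spanning ; independent = independent }

        result : HermiteBasis v
        result = record
          { e = e ; a = a ; expand = expand ; upper = upper ; positive = positive ; reduced = reduced
          ; basis = isBasis }

    nonzero : ∀ {n k} (v : Vector (ℤ^ n) (suc k)) → Indepᴷ v → ¬ (∀ l → v zero l ≡ 0ℤ)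
    nonzero {k = k} v ind z = contradiction (ι-zero 1ℤ (K.trans ι-1 (ind (1# ∷ λ _ → 0#) rel zero))) λ ()
      where
      rel : ∀ l → 1# K.* ι (v zero l) K.+ ΣK.sum (λ (i : Fin k) → 0# K.* ι (v (suc i) l)) ≈ 0#
      rel l = K.trans (K.+-cong (K.trans (K.*-congˡ (K.trans (ι-cong (z l)) ι-0)) (K.zeroʳ 1#))
                (sumK-0 _ (λ i → K.zeroˡ (ι (v (suc i) l))))) (K.+-identityˡ 0#)

    module _ {n k} (rec : (w : Vector (ℤ^ n) k) → Indepᴷ w → HermiteBasis w) where
      ascend : (v : Vector (ℤ^ (suc n)) (suc k)) → Indepᴷ v → ToFirst (v zero) → HermiteBasis v
      ascend v ind record { aut = φ ; d = zero ; top = top ; rest = rest } =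
        ⊥-elim (nonzero (Aut.to φ ∘ v) (transportIndep φ v ind) λ { zero → top ; (suc l) → rest l })
      ascend v ind record { aut = φ ; d = suc d ; top = top ; rest = rest } =
        transport φ v (Step.result v′ pos rest ind′ (rec _ (Step.indep-w v′ pos rest ind′)))
        where
        v′ : Vector (ℤ^ (suc n)) (suc k)
        v′ = Aut.to φ ∘ v
        pos : 0ℤ ℤ.< v′ zero zero
        pos = subst (0ℤ ℤ.<_) (sym top) (ℤ.+<+ (ℕ.s≤s ℕ.z≤n))
        ind′ : Indepᴷ v′
        ind′ = transportIndep φ v ind

    module _ {n} (v : Vector (ℤ^ n) 0) where
      noVectors : Vector (ℤ^ n) 0
      noVectors ()

      emptyBasis : IsBasis noVectors (Γ v)
      emptyBasis = record
        { member      = λ ()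
        ; spanning    = λ { x (c , p) → (λ ()) , λ l → ι-zero (x l) (p l) }
        ; independent = λ m z () }

      empty : HermiteBasis v
      empty = record
        { e        = noVectors
        ; basis    = emptyBasis
        ; a        = λ ()
        ; expand   = λ ()
        ; upper    = λ ()
        ; positive = λ ()
        ; reduced  = λ () }

    hermiteBasis : ∀ {n} k (v : Vector (ℤ^ n) k) → Indepᴷ v → HermiteBasis v
    hermiteBasis zero v ind = empty v
    hermiteBasis {zero}  (suc k) v ind = ⊥-elim (nonzero v ind λ ())
    hermiteBasis {suc n} (suc k) v ind = ascend (hermiteBasis k) v ind (toFirst n (v zero))

    ι-neg : ∀ x → ι (ℤ.- x) ≈ K.- ι x
    ι-neg x = KP.+-inverseˡ-unique (ι (ℤ.- x)) (ι x)
                (K.trans (K.sym (ι-+ (ℤ.- x) x)) (K.trans (ι-cong (ℤ.+-inverseˡ x)) ι-0))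

    indep-negate : ∀ {n k} (v : Vector (ℤ^ n) k) i → Indepᴷ v → Indepᴷ (updateAt v i negate)
    indep-negate {n} {k} v i ind c z j = back j (ind c′ rel j)
      where
      v′ : Vector (ℤ^ n) k
      v′ = updateAt v i negate
      c′ : Vector K.Carrier k
      c′ = updateAt c i (λ x → K.- x)
      term : ∀ l j → c′ j K.* ι (v j l) ≈ c j K.* ι (v′ j l)
      term l j with i Fin.≟ j
      ... | yes refl = begin
        c′ i K.* ι (v i l)        ≈⟨ K.*-congʳ (K.reflexive (Vec.updateAt-updates i c)) ⟩
        (K.- c i) K.* ι (v i l)   ≈⟨ KP.-‿distribˡ-* (c i) (ι (v i l)) ⟨
        K.- (c i K.* ι (v i l))   ≈⟨ KP.-‿distribʳ-* (c i) (ι (v i l)) ⟩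
        c i K.* (K.- ι (v i l))   ≈⟨ K.*-congˡ (ι-neg (v i l)) ⟨
        c i K.* ι (ℤ.- v i l)     ≈⟨ K.*-congˡ (ι-cong (cong (λ w → w l) (Vec.updateAt-updates i v))) ⟨
        c i K.* ι (v′ i l)        ∎
      ... | no i≢j = K.*-cong (K.reflexive (Vec.updateAt-minimal j i c (i≢j ∘ sym)))
                       (ι-cong (cong (λ w → w l) (sym (Vec.updateAt-minimal j i v (i≢j ∘ sym)))))
      rel : ∀ l → ΣK.sum (λ j → c′ j K.* ι (v j l)) ≈ 0#
      rel l = K.trans (ΣK.sum-cong-≋ (term l)) (z l)
      back : ∀ j → c′ j ≈ 0# → c j ≈ 0#
      back j p with i Fin.≟ j
      ... | yes refl = KP.-‿injective (K.trans (K.trans (K.reflexive (sym (Vec.updateAt-updates i c))) p)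
                         (K.sym KP.-0#≈0#))
      ... | no i≢j = K.trans (K.reflexive (sym (Vec.updateAt-minimal j i c (i≢j ∘ sym)))) p

    indep-remove : ∀ {n k} (v : Vector (ℤ^ n) (suc k)) i → Indepᴷ v → Indepᴷ (removeAt v i)
    indep-remove {n} {k} v i ind c z j =
      K.trans (K.reflexive (sym (Vec.insertAt-punchIn c i 0# j))) (ind c′ rel (punchIn i j))
      where
      c′ : Vector K.Carrier (suc k)
      c′ = insertAt c i 0#
      rel : ∀ l → ΣK.sum (λ j → c′ j K.* ι (v j l)) ≈ 0#
      rel l = begin
        ΣK.sum (λ j → c′ j K.* ι (v j l))
          ≈⟨ ΣK.sum-remove {i = i} (λ j → c′ j K.* ι (v j l)) ⟩
        c′ i K.* ι (v i l) K.+ ΣK.sum (λ j → c′ (punchIn i j) K.* ι (v (punchIn i j) l))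
          ≈⟨ K.+-cong (K.trans (K.*-congʳ (K.reflexive (Vec.insertAt-lookup c i 0#))) (K.zeroˡ (ι (v i l))))
               (ΣK.sum-cong-≋ (λ j → K.*-congʳ (K.reflexive (Vec.insertAt-punchIn c i 0# j)))) ⟩
        0# K.+ ΣK.sum (λ j → c j K.* ι (removeAt v i j l))
          ≈⟨ K.trans (K.+-identityˡ _) (z l) ⟩
        0# ∎

open Lattice ℝ-commutativeRing fromℤ public
  using (Combᴷ; Indepᴷ; Γ; Combℤ; Spanℤ; Indepℤ; IsBasis; HermiteBasis)

module Proofs = Lattice.Existence ℝ-commutativeRing fromℤ
                  fromℤ-0 fromℤ-1 fromℤ-+ fromℤ-* fromℤ-zero fromℤ-inv

Primitive : ∀ {n} → ℤ^ n → Set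
Primitive v = ∀ (d : ℕ) → (∀ l → d ∣ ℤ.∣ v l ∣) → d ≡ 1

-- k≤n already follows from indep.
record Cone (n k : ℕ) : Set where
  field
    k≤n : k ℕ.≤ n
    vertex : ℤ^ n
    edge : Vector (ℤ^ n) k
    edge-primitive : ∀ i → Primitive (edge i)
    indep : Indepᴷ edge

-- Such a basis is unique, so lsin does not depend on the one constructed here.
hermite : ∀ {n k} (α : Cone n k) → HermiteBasis (Cone.edge α)
hermite {n} {k} α = Proofs.hermiteBasis k (Cone.edge α) (Cone.indep α)

-- lsin α i is the i-th integer sine, with i counted from 0 (so lsin_k is at fromℕ (k - 1)).
lsin : ∀ {n k} → Cone n k → Fin k → ℤ
lsin α i = HermiteBasis.a (hermite α) i i

-- [G : H] = m: every element of G is congruent modulo H to exactly one of m representatives.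
record HasIndex {n} (G H : Pred (ℤ^ n) 0ℓ) (m : ℕ) : Set where
  field
    rep      : Vector (ℤ^ n) m
    rep∈G    : ∀ p → rep p ∈ G
    covers   : ∀ x → x ∈ G → ∃[ p ] (λ l → x l ℤ.- rep p l) ∈ H
    distinct : ∀ p q → (λ l → rep p l ℤ.- rep q l) ∈ H → p ≡ q

-- The integer sine of β, as an index, is the given number.
HasIntegerSine : ∀ {n k} → Cone n k → ℕ → Set
HasIntegerSine β = HasIndex (Γ (Cone.edge β)) (Spanℤ (Cone.edge β))

-- The face generated by all edge vectors but the i-th.
facet : ∀ {n k} → Cone n (suc k) → Fin (suc k) → Cone n k
facet α i = record
  { k≤n = ℕ.≤-trans (ℕ.n≤1+n _) α.k≤n
  ; vertex = α.vertex
  ; edge = removeAt α.edge i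
  ; edge-primitive = λ j → α.edge-primitive (punchIn i j)
  ; indep = Proofs.indep-remove α.edge i α.indep
  }
  where
  module α = Cone α

Simple : ∀ {n k} → Cone n (suc k) → Set
Simple α = ∀ i → HasIntegerSine (facet α i) 1

adjacent : ∀ {n k} → Fin k → Cone n k → Cone n k
adjacent i α = record
  { k≤n = α.k≤n
  ; vertex = α.vertex
  ; edge = updateAt α.edge i negate
  ; edge-primitive = prim
  ; indep = Proofs.indep-negate α.edge i α.indep
  }
  where
  module α = Cone α
  prim : ∀ j → Primitive (updateAt α.edge i negate j)
  prim j with i Fin.≟ j
  ... | yes refl = λ d p → α.edge-primitive i d λ l → subst (d ∣_)
          (trans (cong (λ w → ℤ.∣ w l ∣) (Vec.updateAt-updates i α.edge)) (ℤ.∣-i∣≡∣i∣ (α.edge i l))) (p l)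
  ... | no i≢j = subst Primitive (sym (Vec.updateAt-minimal j i α.edge (i≢j ∘ sym))) (α.edge-primitive j)

{-# OPTIONS --safe #-}
-- Let L be the last index. Since the facet opposite v_L has integer sine 1, the Hermite basis
-- vectors e_j with j < L, which lie in the span of that facet, are integer combinations of
-- the edges. So the integers m with m Γ ⊆ ℤv₁ + … + ℤv_k are exactly the multiples of a_LL:
-- a_LL e_L is an integer combination of v_L and the e_j with j < L, and conversely the
-- e_L-coordinate of any integer combination of the edges is a multiple of a_LL. Both Γ and
-- ℤv₁ + … + ℤv_k are unchanged when an edge changes sign, hence so is a_LL.
module Submission where

open import Algebra.Bundles using (CommutativeRing)
open import Data.Fin using (Fin; zero; suc; fromℕ; punchIn; punchOut)
import Data.Fin as Fin
import Data.Fin.Induction as Fin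
import Data.Fin.Properties as Fin
open import Data.Integer using (ℤ; +_; 0ℤ; 1ℤ; -1ℤ)
import Data.Integer as ℤ
import Data.Integer.Properties as ℤ
open import Data.Integer.Tactic.RingSolver using (solve-∀)
open import Data.Nat using (ℕ; suc; _≤_)
open import Data.Nat.Divisibility using (_∣_; divides; ∣-antisym)
open import Data.Product using (∃-syntax; _,_; proj₁; proj₂)
open import Data.Sum using (_⊎_; inj₁; inj₂)
open import Data.Vec.Functional using (Vector; removeAt; updateAt)
import Data.Vec.Functional.Properties as Vec
open import Function using (_∘_)
open import Induction.WellFounded using (Acc; acc)
open import Level using (0ℓ)
open import Relation.Binary.Definitions using (tri<; tri≈; tri>)
open import Relation.Binary.PropositionalEquality
  using (_≡_; _≢_; _≗_; refl; sym; trans; cong; cong₂; subst; module ≡-Reasoning)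
open import Relation.Nullary using (yes; no; contradiction)
open import Relation.Unary using (Pred; _∈_; _⊆′_)
open import Defs

-- Transitivity of linear combinations, over ℝ and over ℤ.

module Transitivity (K : CommutativeRing 0ℓ 0ℓ) (ι : ℤ → CommutativeRing.Carrier K) where
  open Lattice K ι using (module K; module ΣK) renaming (Combᴷ to Comb; Γ to Span)
  open import Relation.Binary.Reasoning.Setoid K.setoid

  comb-trans : ∀ {n k m} (c : Vector K.Carrier m) (u : Vector (ℤ^ n) m) (x : ℤ^ n)
               (d : Fin m → Vector K.Carrier k) (w : Vector (ℤ^ n) k) →
               Comb c u x → (∀ i → Comb (d i) w (u i)) →
               Comb (λ j → ΣK.sum (λ i → c i K.* d i j)) w x
  comb-trans c u x d w p q l = begin
    ι (x l)
      ≈⟨ p l ⟩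
    ΣK.sum (λ i → c i K.* ι (u i l))
      ≈⟨ ΣK.sum-cong-≋ (λ i → K.trans (K.*-congˡ (q i l))
           (K.trans (ΣK.*-distribˡ-sum (c i) (λ j → d i j K.* ι (w j l)))
             (ΣK.sum-cong-≋ (λ j → K.sym (K.*-assoc (c i) (d i j) (ι (w j l))))))) ⟩
    ΣK.sum (λ i → ΣK.sum (λ j → c i K.* d i j K.* ι (w j l)))
      ≈⟨ ΣK.∑-comm (λ i j → c i K.* d i j K.* ι (w j l)) ⟩
    ΣK.sum (λ j → ΣK.sum (λ i → c i K.* d i j K.* ι (w j l)))
      ≈⟨ ΣK.sum-cong-≋ (λ j → ΣK.*-distribʳ-sum (ι (w j l)) (λ i → c i K.* d i j)) ⟨
    ΣK.sum (λ j → ΣK.sum (λ i → c i K.* d i j) K.* ι (w j l)) ∎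

  span-trans : ∀ {n k m} (u : Vector (ℤ^ n) m) (w : Vector (ℤ^ n) k) →
               (∀ i → u i ∈ Span w) → Span u ⊆′ Span w
  span-trans u w q x (c , p) = _ , comb-trans c u x (proj₁ ∘ q) w p (proj₂ ∘ q)

open Transitivity ℝ-commutativeRing fromℤ using () renaming (span-trans to Γ-trans)
-- With the identity as `ι`, `Comb` and `Span` unfold to `Combℤ` and `Spanℤ`.
open Transitivity ℤ.+-*-commutativeRing (λ x → x) using ()
  renaming (comb-trans to Combℤ-trans; span-trans to Spanℤ-trans)

-- One-term combinations and uniqueness of coordinates.

sum-single : ∀ {k} (f : Vector ℤ k) j → (∀ i → i ≢ j → f i ≡ 0ℤ) → Σℤ.sum f ≡ f j
sum-single {suc k} f j z = begin
  Σℤ.sum f                          ≡⟨ Σℤ.sum-remove {i = j} f ⟩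
  f j ℤ.+ Σℤ.sum (removeAt f j)     ≡⟨ cong (ℤ._+_ (f j)) (Proofs.sumℤ-0 _ (λ i → z _ (Fin.punchInᵢ≢i j i))) ⟩
  f j ℤ.+ 0ℤ                        ≡⟨ ℤ.+-identityʳ (f j) ⟩
  f j                               ∎
  where open ≡-Reasoning

infixr 7 _•_
_•_ : ∀ {n} → ℤ → ℤ^ n → ℤ^ n
(d • x) l = d ℤ.* x l

single : ∀ {k} → Fin k → ℤ → Vector ℤ k
single j d = updateAt (λ _ → 0ℤ) j (λ _ → d)

comb-single : ∀ {n k} (v : Vector (ℤ^ n) k) j d → Combℤ (single j d) v (d • v j)
comb-single v j d l = sym (trans
  (sum-single (λ i → single j d i ℤ.* v i l) j λ i i≢j →
    cong (ℤ._* v i l) (Vec.updateAt-minimal i j (λ _ → 0ℤ) i≢j))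
  (cong (ℤ._* v j l) (Vec.updateAt-updates j (λ _ → 0ℤ))))

comb-unique : ∀ {n k} (e : Vector (ℤ^ n) k) → Indepℤ e → ∀ c d x →
              Combℤ c e x → Combℤ d e x → c ≗ d
comb-unique e ind c d x p q i = ℤ.i-j≡0⇒i≡j (c i) (d i) (ind (λ j → c j ℤ.- d j) rel i)
  where
  open ≡-Reasoning
  split : ∀ a b z → (a ℤ.- b) ℤ.* z ≡ a ℤ.* z ℤ.+ -1ℤ ℤ.* (b ℤ.* z)
  split = solve-∀
  cancel : ∀ z → z ℤ.+ -1ℤ ℤ.* z ≡ 0ℤ
  cancel = solve-∀
  rel : ∀ l → Σℤ.sum (λ j → (c j ℤ.- d j) ℤ.* e j l) ≡ 0ℤ
  rel l = begin
    Σℤ.sum (λ j → (c j ℤ.- d j) ℤ.* e j l)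
      ≡⟨ Σℤ.sum-cong-≗ (λ j → split (c j) (d j) (e j l)) ⟩
    Σℤ.sum (λ j → c j ℤ.* e j l ℤ.+ -1ℤ ℤ.* (d j ℤ.* e j l))
      ≡⟨ Σℤ.∑-distrib-+ (λ j → c j ℤ.* e j l) (λ j → -1ℤ ℤ.* (d j ℤ.* e j l)) ⟩
    Σℤ.sum (λ j → c j ℤ.* e j l) ℤ.+ Σℤ.sum (λ j → -1ℤ ℤ.* (d j ℤ.* e j l))
      ≡⟨ cong₂ ℤ._+_ (sym (p l))
           (trans (sym (Σℤ.*-distribˡ-sum -1ℤ (λ j → d j ℤ.* e j l))) (cong (-1ℤ ℤ.*_) (sym (q l)))) ⟩
    x l ℤ.+ -1ℤ ℤ.* x l
      ≡⟨ cancel (x l) ⟩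
    0ℤ ∎

-- Subgroups of ℤⁿ: integer spans, the lattices `Γ`, index 1.

-- Closed G says that G is a subgroup of ℤⁿ (and respects pointwise equality).
Closed : ∀ {n} → Pred (ℤ^ n) 0ℓ → Set
Closed {n} G = ∀ {m} (u : Vector (ℤ^ n) m) → (∀ i → u i ∈ G) → Spanℤ u ⊆′ G

Spanℤ-closed : ∀ {n k} (w : Vector (ℤ^ n) k) → Closed (Spanℤ w)
Spanℤ-closed w u = Spanℤ-trans u w

Spanℤ⊆Γ : ∀ {n k} (v : Vector (ℤ^ n) k) → Spanℤ v ⊆′ Γ v
Spanℤ⊆Γ v x (m , p) = fromℤ ∘ m , Proofs.toK m v x p

Γ-closed : ∀ {n k} (w : Vector (ℤ^ n) k) → Closed (Γ w)
Γ-closed w u u∈ x x∈ = Γ-trans u w u∈ x (Spanℤ⊆Γ u x x∈)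

-- A real combination giving `d • x` can be scaled by the real inverse of `d`. The analogue for
-- `Spanℤ` fails, which is why saturation of a facet carries information.
Γ-divisible : ∀ {n k} (w : Vector (ℤ^ n) k) d → 0ℤ ℤ.< d → ∀ x → d • x ∈ Γ w → x ∈ Γ w
Γ-divisible {n} w d d>0 x dx∈ with fromℤ-inv d d>0
... | u , ud≈1 = Γ-trans {m = 1} (λ _ → d • x) w (λ _ → dx∈) x ((λ _ → u) , λ l → K.sym (eq l))
  where
  module K = CommutativeRing ℝ-commutativeRing
  open import Relation.Binary.Reasoning.Setoid K.setoid
  eq : ∀ l → u *ᴿ fromℤ (d ℤ.* x l) +ᴿ K.0# ≈ᴿ fromℤ (x l)
  eq l = begin
    u *ᴿ fromℤ (d ℤ.* x l) +ᴿ K.0#     ≈⟨ K.+-identityʳ _ ⟩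
    u *ᴿ fromℤ (d ℤ.* x l)             ≈⟨ K.*-congˡ (fromℤ-* d (x l)) ⟩
    u *ᴿ (fromℤ d *ᴿ fromℤ (x l))      ≈⟨ K.*-assoc u (fromℤ d) (fromℤ (x l)) ⟨
    u *ᴿ fromℤ d *ᴿ fromℤ (x l)        ≈⟨ K.*-congʳ ud≈1 ⟩
    K.1# *ᴿ fromℤ (x l)                ≈⟨ K.*-identityˡ _ ⟩
    fromℤ (x l)                        ∎

module _ {n} (G : Pred (ℤ^ n) 0ℓ) (closed : Closed G) where

  closed-0 : ∀ x → (∀ l → x l ≡ 0ℤ) → x ∈ G
  closed-0 x z = closed {m = 0} (λ ()) (λ ()) x ((λ ()) , z)

  closed-• : ∀ d {x y} → y ≗ d • x → x ∈ G → y ∈ G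
  closed-• d {x} {y} eq x∈ = closed {m = 1} (λ _ → x) (λ _ → x∈) y
    ((λ _ → d) , λ l → trans (eq l) (sym (ℤ.+-identityʳ _)))

  closed-+ : ∀ {x y z} → (∀ l → z l ≡ x l ℤ.+ y l) → x ∈ G → y ∈ G → z ∈ G
  closed-+ {x} {y} {z} eq x∈ y∈ = closed {m = 2} (λ { zero → x ; (suc _) → y })
    (λ { zero → x∈ ; (suc _) → y∈ }) z ((λ _ → 1ℤ) , λ l → trans (eq l) (unfold (x l) (y l)))
    where
    unfold : ∀ a b → a ℤ.+ b ≡ 1ℤ ℤ.* a ℤ.+ (1ℤ ℤ.* b ℤ.+ 0ℤ)
    unfold = solve-∀

  closed-sum : ∀ {m} (u : Vector (ℤ^ n) m) → (∀ i → u i ∈ G) → (λ l → Σℤ.sum (λ i → u i l)) ∈ G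
  closed-sum u u∈ = closed u u∈ _ ((λ _ → 1ℤ) , λ l → Σℤ.sum-cong-≗ (λ i → sym (ℤ.*-identityˡ (u i l))))

-- Both `x` and 0 are congruent modulo `H` to the only representative, hence to each other. The
-- representative itself may be nonzero.
index-1 : ∀ {n} (G H : Pred (ℤ^ n) 0ℓ) → Closed G → Closed H → HasIndex G H 1 → G ⊆′ H
index-1 G H closedG closedH I x x∈ with I.covers x x∈ | I.covers (λ _ → 0ℤ) (closed-0 G closedG _ (λ _ → refl))
  where module I = HasIndex I
... | zero , p | zero , q =
  closed-+ H closedH {y = -1ℤ • (λ l → 0ℤ ℤ.- rep zero l)} (λ l → shift (x l) (rep zero l)) p
    (closed-• H closedH -1ℤ (λ _ → refl) q)
  where
  open HasIndex I using (rep)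
  shift : ∀ a r → a ≡ (a ℤ.- r) ℤ.+ -1ℤ ℤ.* (0ℤ ℤ.- r)
  shift = solve-∀

edge∈Spanℤ : ∀ {n k} (v : Vector (ℤ^ n) k) i → v i ∈ Spanℤ v
edge∈Spanℤ v i = single i 1ℤ , λ l → trans (sym (ℤ.*-identityˡ (v i l))) (comb-single v i 1ℤ l)

removeAt-Spanℤ : ∀ {n k} (v : Vector (ℤ^ n) (suc k)) i → Spanℤ (removeAt v i) ⊆′ Spanℤ v
removeAt-Spanℤ v i = Spanℤ-trans (removeAt v i) v (edge∈Spanℤ v ∘ punchIn i)

-- Consequences of the triangular shape of a Hermite basis.

module _ {n k} {v : Vector (ℤ^ n) (suc k)} (H : HermiteBasis v) where
  open HermiteBasis H
  open IsBasis basis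

  -- Solve the expansion of `v j` for its diagonal term: the terms below `j` lie in `G` by
  -- assumption, those above `j` vanish by `upper`.
  diagonal : (G : Pred (ℤ^ n) 0ℓ) → Closed G → ∀ j → v j ∈ G →
             (∀ i → i Fin.< j → e i ∈ G) → a j j • e j ∈ G
  diagonal G closed j vj∈ e∈ =
    closed-+ G closed {x = v j} {y = -1ℤ • rest} eq vj∈
      (closed-• G closed -1ℤ (λ _ → refl) (closed-sum G closed _ λ i → other (punchIn j i) (Fin.punchInᵢ≢i j i)))
    where
    term : Fin (suc k) → ℤ^ n
    term i = a i j • e i
    rest : ℤ^ n
    rest l = Σℤ.sum (λ i → term (punchIn j i) l)
    other : ∀ i → i ≢ j → term i ∈ G
    other i i≢j with Fin.<-cmp i j
    ... | tri< i<j _ _ = closed-• G closed (a i j) (λ _ → refl) (e∈ i i<j)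
    ... | tri≈ _ i≡j _ = contradiction i≡j i≢j
    ... | tri> _ _ j<i = closed-0 G closed _ λ l → cong (ℤ._* e i l) (upper i j j<i)
    move : ∀ t r → t ≡ (t ℤ.+ r) ℤ.+ -1ℤ ℤ.* r
    move = solve-∀
    eq : ∀ l → term j l ≡ v j l ℤ.+ -1ℤ ℤ.* rest l
    eq l = trans (move (term j l) (rest l)) (cong (ℤ._+ -1ℤ ℤ.* rest l)
      (sym (trans (expand j l) (Σℤ.sum-remove {i = j} (λ i → term i l)))))

  -- Well-founded induction on `j`: `diagonal` puts a positive multiple of `e j` into `Γ w`, and
  -- `Γ-divisible` removes the factor.
  initial∈Γ : ∀ {m} (w : Vector (ℤ^ n) m) t → (∀ i → i Fin.< t → v i ∈ Γ w) →
              ∀ j → j Fin.< t → e j ∈ Γ w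
  initial∈Γ w t v∈ j = go j (Fin.<-wellFounded j)
    where
    go : ∀ j → Acc Fin._<_ j → j Fin.< t → e j ∈ Γ w
    go j (acc rs) j<t = Γ-divisible w (a j j) (positive j) (e j)
      (diagonal (Γ w) (Γ-closed w) j (v∈ j j<t) λ i i<j → go i (rs i<j) (Fin.<-trans i<j j<t))

  private
    last : Fin (suc k)
    last = fromℕ k

    <last : ∀ j → j ≢ last → j Fin.< last
    <last j = Fin.≤∧≢⇒< (Fin.≤fromℕ j)

  -- It suffices to scale each basis vector into the edge lattice. Those before the last are already
  -- there, by saturation of the facet; for the last one `diagonal` applies.
  last-annihilates : Γ (removeAt v last) ⊆′ Spanℤ (removeAt v last) →
                     ∀ x → x ∈ Γ v → a last last • x ∈ Spanℤ v
  last-annihilates saturated x x∈ with spanning x x∈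
  ... | m , p = Spanℤ-closed v (λ j → a last last • e j) scaled∈ (a last last • x) (m , λ l →
      trans (cong (a last last ℤ.*_) (p l)) (trans (Σℤ.*-distribˡ-sum (a last last) (λ j → m j ℤ.* e j l))
        (Σℤ.sum-cong-≗ (λ j → swap (a last last) (m j) (e j l)))))
    where
    swap : ∀ a b c → a ℤ.* (b ℤ.* c) ≡ b ℤ.* (a ℤ.* c)
    swap = solve-∀
    facet-edge∈ : ∀ i → i Fin.< last → v i ∈ Γ (removeAt v last)
    facet-edge∈ i i<last = subst (λ j → v j ∈ Γ (removeAt v last))
      -- An index other than `last` is the image under `punchIn` of an index of the facet.
      (Fin.punchIn-punchOut {i = last} {j = i} (Fin.<⇒≢ i<last ∘ sym))
      (Spanℤ⊆Γ (removeAt v last) _ (edge∈Spanℤ (removeAt v last) (punchOut (Fin.<⇒≢ i<last ∘ sym))))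
    initial∈ : ∀ j → j Fin.< last → e j ∈ Spanℤ v
    initial∈ j j<last = removeAt-Spanℤ v last (e j)
      (saturated (e j) (initial∈Γ (removeAt v last) last facet-edge∈ j j<last))
    scaled∈ : ∀ j → a last last • e j ∈ Spanℤ v
    scaled∈ j with j Fin.≟ last
    ... | yes refl = diagonal (Spanℤ v) (Spanℤ-closed v) last (edge∈Spanℤ v last) initial∈
    ... | no j≢last = closed-• (Spanℤ v) (Spanℤ-closed v) (a last last) (λ _ → refl) (initial∈ j (<last j j≢last))

  -- Compare coordinates at `e last`: the left side has `d`, and on the right only `v last`
  -- contributes, since the last row of `a` is zero off the diagonal.
  last-divides : ∀ d → d • e last ∈ Spanℤ v → ∃[ c ] d ≡ c ℤ.* a last last
  last-divides d (c , p) = c last , (begin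
    d
      ≡⟨ Vec.updateAt-updates last (λ _ → 0ℤ) ⟨
    single last d last
      ≡⟨ comb-unique e independent (single last d) coord (d • e last) (comb-single e last d)
           (Combℤ-trans c v (d • e last) (λ i j → a j i) e p expand) last ⟩
    coord last
      ≡⟨ sum-single (λ i → c i ℤ.* a last i) last (λ i i≢last →
           trans (cong (c i ℤ.*_) (upper last i (<last i i≢last))) (ℤ.*-zeroʳ (c i))) ⟩
    c last ℤ.* a last last ∎)
    where
    open ≡-Reasoning
    coord : Vector ℤ (suc k)
    coord j = Σℤ.sum (λ i → c i ℤ.* a j i)

-- Invariance of both lattices under sign changes of edges.

infix 4 _≗±_
-- Allowing a sign at every edge makes the relation between edge families symmetric and lets it pass
-- to facets.
_≗±_ : ∀ {n} → ℤ^ n → ℤ^ n → Set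
x ≗± y = x ≗ y ⊎ x ≗ negate y

≗±-sym : ∀ {n} {x y : ℤ^ n} → x ≗± y → y ≗± x
≗±-sym (inj₁ p) = inj₁ λ l → sym (p l)
≗±-sym (inj₂ p) = inj₂ λ l → trans (sym (ℤ.neg-involutive _)) (cong ℤ.-_ (sym (p l)))

≗±⇒∈Spanℤ : ∀ {n k} {v w : Vector (ℤ^ n) k} → (∀ i → v i ≗± w i) → ∀ i → v i ∈ Spanℤ w
≗±⇒∈Spanℤ {v = v} {w} s i with s i
... | inj₁ p = closed-• (Spanℤ w) (Spanℤ-closed w) 1ℤ
                 (λ l → trans (p l) (sym (ℤ.*-identityˡ (w i l)))) (edge∈Spanℤ w i)
... | inj₂ p = closed-• (Spanℤ w) (Spanℤ-closed w) -1ℤ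
                 (λ l → trans (p l) (sym (ℤ.-1*i≡-i (w i l)))) (edge∈Spanℤ w i)

≗±⇒Spanℤ⊆ : ∀ {n k} {v w : Vector (ℤ^ n) k} → (∀ i → v i ≗± w i) → Spanℤ v ⊆′ Spanℤ w
≗±⇒Spanℤ⊆ {v = v} {w} s = Spanℤ-trans v w (≗±⇒∈Spanℤ s)

≗±⇒Γ⊆ : ∀ {n k} {v w : Vector (ℤ^ n) k} → (∀ i → v i ≗± w i) → Γ v ⊆′ Γ w
≗±⇒Γ⊆ {v = v} {w} s = Γ-trans v w (λ i → Spanℤ⊆Γ w (v i) (≗±⇒∈Spanℤ s i))

negate-≗± : ∀ {n k} (v : Vector (ℤ^ n) k) i j → updateAt v i negate j ≗± v j
negate-≗± v i j with i Fin.≟ j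
... | yes refl = inj₂ λ l → cong (λ x → x l) (Vec.updateAt-updates i v)
... | no i≢j   = inj₁ λ l → cong (λ x → x l) (Vec.updateAt-minimal j i v (i≢j ∘ sym))

-- Comparison of the last integer sines.

-- The last basis vector of `H` lies in `Γ v`, hence in `Γ w`. The last diagonal entry of `H′`
-- scales it into `Spanℤ w`, hence into `Spanℤ v`, and `last-divides` applies to `H`.
last-∣ : ∀ {n k} {v w : Vector (ℤ^ n) (suc k)} (H : HermiteBasis v) (H′ : HermiteBasis w) →
         (∀ i → v i ≗± w i) → Γ (removeAt w (fromℕ k)) ⊆′ Spanℤ (removeAt w (fromℕ k)) →
         ℤ.∣ HermiteBasis.a H (fromℕ k) (fromℕ k) ∣ ∣ ℤ.∣ HermiteBasis.a H′ (fromℕ k) (fromℕ k) ∣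
last-∣ {n} {k} {v} {w} H H′ s saturated =
  divides ℤ.∣ proj₁ quot ∣ (trans (cong ℤ.∣_∣ (proj₂ quot)) (ℤ.abs-* (proj₁ quot) _))
  where
  module H  = HermiteBasis H
  module H′ = HermiteBasis H′
  eₗ : ℤ^ n
  eₗ = H.e (fromℕ k)
  quot : ∃[ c ] H′.a (fromℕ k) (fromℕ k) ≡ c ℤ.* H.a (fromℕ k) (fromℕ k)
  quot = last-divides H _ (≗±⇒Spanℤ⊆ {v = w} {v} (λ i → ≗±-sym (s i)) _
           (last-annihilates H′ saturated eₗ (≗±⇒Γ⊆ {v = v} {w} s eₗ (IsBasis.member H.basis (fromℕ k)))))

-- Divisibility holds in both directions, and positivity of the diagonal entries fixes the sign.
last-≡ : ∀ {n k} {v w : Vector (ℤ^ n) (suc k)} (H : HermiteBasis v) (H′ : HermiteBasis w) →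
         (∀ i → v i ≗± w i) → Γ (removeAt v (fromℕ k)) ⊆′ Spanℤ (removeAt v (fromℕ k)) →
         HermiteBasis.a H (fromℕ k) (fromℕ k) ≡ HermiteBasis.a H′ (fromℕ k) (fromℕ k)
last-≡ {n} {k} {v} {w} H H′ s saturated = begin
  H.a (fromℕ k) (fromℕ k)               ≡⟨ ℤ.0≤i⇒+∣i∣≡i (ℤ.<⇒≤ (H.positive (fromℕ k))) ⟨
  + ℤ.∣ H.a (fromℕ k) (fromℕ k) ∣       ≡⟨ cong +_ (∣-antisym (last-∣ H H′ s saturated′)
                                                              (last-∣ H′ H (λ i → ≗±-sym (s i)) saturated)) ⟩
  + ℤ.∣ H′.a (fromℕ k) (fromℕ k) ∣      ≡⟨ ℤ.0≤i⇒+∣i∣≡i (ℤ.<⇒≤ (H′.positive (fromℕ k))) ⟩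
  H′.a (fromℕ k) (fromℕ k)              ∎
  where
  open ≡-Reasoning
  module H  = HermiteBasis H
  module H′ = HermiteBasis H′
  v′ w′ : Vector (ℤ^ n) k
  v′ = removeAt v (fromℕ k)
  w′ = removeAt w (fromℕ k)
  s′ : ∀ i → v′ i ≗± w′ i
  s′ = s ∘ punchIn (fromℕ k)
  -- Saturation is transferred from the facet of `v` to that of `w`, whose real and integer spans
  -- are the same.
  saturated′ : Γ w′ ⊆′ Spanℤ w′
  saturated′ x x∈ = ≗±⇒Spanℤ⊆ {v = v′} {w′} s′ x
    (saturated x (≗±⇒Γ⊆ {v = w′} {v′} (λ i → ≗±-sym (s′ i)) x x∈))

proposition3p13 : (n k : ℕ) → 2 ≤ suc k → (α : Cone n (suc k)) → Simple α →
    (i : Fin (suc k)) → lsin α (fromℕ k) ≡ lsin (adjacent i α) (fromℕ k)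
proposition3p13 n k _ α simple i =
  last-≡ (hermite α) (hermite (adjacent i α)) (λ j → ≗±-sym (negate-≗± edge i j))
    -- Simplicity at the facet opposite the last edge, read as saturation of that facet.
    (index-1 (Γ facetEdge) (Spanℤ facetEdge) (Γ-closed facetEdge) (Spanℤ-closed facetEdge) (simple (fromℕ k)))
  where
  open Cone α using (edge)
  facetEdge : Vector (ℤ^ n) k
  facetEdge = removeAt edge (fromℕ k)
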